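{- For a finite simple graph $G$ the following statements are equivalent: (1) $G$ admits a $\{{}^bP_3,{}^rP_3,{}^bK_3\}$-free $2$-edge-colouring. (2) $G$ admits a $\{{}^bP_3,{}^rP_3,{}^rK_3\}$-free $2$-edge-colouring. (3) $G$ admits a $\{{}^bP_3,{}^rP_3,{}^bK_3,{}^{rrb}K_3\}$-free $2$-edge-colouring. (4) $G$ admits a $\{{}^bP_3,{}^rP_3,{}^rK_3,{}^{rbb}K_3\}$-free $2$-edge-colouring. (5) $G$ is an $X$-augmentation of the line graph of an incidence multigraph $H(X,Y)$. (6) $G$ is an $X$-augmentation of the line graph of an incidence graph $H(X,Y)$.
   Context: Graphs are finite and simple unless called multigraphs (which may have parallel edges, no loops). A $2$-edge-colouring of $G$ assigns to every edge the colour red or blue (not necessarily properly). For a set $\mathcal F$ of $2$-edge-coloured graphs, a $2$-edge-colouring of $G$ is $\mathcal F$-free if no induced $2$-edge-coloured subgraph is isomorphic (preserving colours) to a member of $\mathcal F$. Patterns on three vertices: ${}^rP_3$ (resp. ${}^bP_3$) is the path on three vertices with both edges red (resp. blue); ${}^rK_3$ (resp. ${}^bK_3$) is the triangle with all edges red (resp. blue); ${}^{rrb}K_3$ is the triangle with two red and one blue edge; ${}^{rbb}K_3$ is the triangle with one red and two blue edges. The line graph of a (multi)graph $H$ is the simple graph with vertex set $E(H)$, two distinct edges being adjacent iff they share at least one endpoint (so parallel edges are adjacent). An incidence graph $H(X,Y)$ is a bipartite graph with bipartition $(X,Y)$ in which every $x\in X$ has degree at most $2$. An incidence multigraph $H(X,Y)$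 is a bipartite multigraph with bipartition $(X,Y)$ in which $|N(x)|\le 2$ for every $x\in X$ (parallel edges allowed). Augmentations: an edge of a graph is flat if it lies in no triangle. Let $xy$ be a flat edge of a graph $G_0$ and let $B=(A,C)$ be a co-bipartite graph disjoint from $G_0$ whose vertex set is partitioned into cliques $A$ and $C$, with at least one edge between $A$ and $C$. Augmenting $G_0$ along $xy$ with augment $B$ means taking the disjoint union of $G_0-\{x,y\}$ and $B$ and adding all edges between $A$ and $N(x)\setminus\{y\}$ and all edges between $C$ and $N(y)\setminus\{x\}$. An augmentation of $G_0$ is a graph obtained by choosing a (possibly empty) matching $x_1y_1,\dots,x_ky_k$ of flat edges of $G_0$ and co-bipartite graphs $B_i=(A_i,C_i)$ with at least one $A_iC_i$-edge, and augmenting each $x_iy_i$ with augment $B_i$ (the order is irrelevant). If $G_0$ is the line graph of a bipartite multigraph $H(X,Y)$ and the matching is $e_1f_1,\dots,e_kf_k$ (so the $e_i,f_i$ are edges of $H$), the augmentation is an $X$-augmentation if for each $i$ there is a vertex $x_i\in X$ incident in $H$ with both $e_i$ and $f_i$. -}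

module Defs where

open import Level using (0ℓ)
open import Data.Empty using (⊥-elim)
open import Data.Fin.Base using (Fin; zero; suc; toℕ)
open import Data.Fin.Properties using (any?; _≟_)
open import Data.Fin.Subset using (Subset; ∣_∣)
open import Data.List.Base using (List)
open import Data.List.Membership.Propositional using (_∈_)
open import Data.Nat.Base as ℕ using (ℕ; _≤_)
import Data.Nat.Properties as ℕ
open import Data.Product.Base using (Σ; ∃; _×_; _,_)
open import Data.Refinement using (Refinement; value)
open import Data.Sum.Base using (_⊎_; inj₁; inj₂; [_,_]′)
import Data.Sum.Base as Sum
open import Data.Unit.Base using (⊤; tt)
open import Data.Vec.Base using (tabulate)
open import Function.Base using (_∘_)
open import Function.Bundles using (_↔_; _⇔_; Inverse; Equivalence)
open import Relation.Binary.Core using (Rel)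
open import Relation.Binary.Definitions using (Symmetric; Irreflexive)
import Relation.Binary.Definitions as Binary
open import Relation.Binary.PropositionalEquality using (_≡_; _≢_; refl; sym; ≢-sym)
open import Relation.Nullary using (¬_; Dec; yes; no; does; ¬?; _×-dec_; _⊎-dec_)
import Relation.Nullary.Decidable as Dec
open import Relation.Unary using (Pred; Decidable)

------------------------------------------------------------------------
-- Simple graphs

record SimpleGraph (V : Set) : Set₁ where
  field
    Adj        : Rel V 0ℓ
    adj?       : Binary.Decidable Adj
    adj-sym    : Symmetric Adj
    adj-irrefl : Irreflexive _≡_ Adj

open SimpleGraph public

infix 4 _≅_ _≅ᶜ_

record _≅_ {V W : Set} (G : SimpleGraph V) (H : SimpleGraph W) : Set where
  field
    bijection : V ↔ W
    adj⇔      : ∀ u v → Adj G u v ⇔ Adj H (Inverse.to bijection u) (Inverse.to bijection v)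

open _≅_ public

-- An edge that lies in no triangle.
Flat : ∀ {V} → SimpleGraph V → V → V → Set
Flat G u v = Adj G u v × (∀ w → ¬ (Adj G u w × Adj G v w))

induced : ∀ {V} → SimpleGraph V → (S : Pred V 0ℓ) → SimpleGraph (Refinement V S)
induced G S = record
  { Adj        = λ u v → Adj G (value u) (value v)
  ; adj?       = λ u v → adj? G (value u) (value v)
  ; adj-sym    = adj-sym G
  ; adj-irrefl = λ { refl → adj-irrefl G refl }
  }

------------------------------------------------------------------------
-- 2-edge-colourings

data Colour : Set where
  red blue : Colour

-- Taking p and q arbitrary in colour-sym also makes the colour of an edge
-- independent of the proof of adjacency.
record Colouring {V : Set} (G : SimpleGraph V) : Set where
  field
    colour     : ∀ {u v} → Adj G u v → Colour
    colour-sym : ∀ {u v} (p : Adj G u v) (q : Adj G v u) → colour p ≡ colour q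

open Colouring public

record ColouredGraph (V : Set) : Set₁ where
  constructor _,_
  field
    graph     : SimpleGraph V
    colouring : Colouring graph

open ColouredGraph public

record _≅ᶜ_ {V W : Set} (G : ColouredGraph V) (H : ColouredGraph W) : Set where
  field
    iso     : graph G ≅ graph H
    colour≡ : ∀ {u v} (p : Adj (graph G) u v) →
              colour (colouring H) (Equivalence.to (adj⇔ iso u v) p) ≡ colour (colouring G) p

open _≅ᶜ_ public

inducedᶜ : ∀ {V} → ColouredGraph V → (S : Pred V 0ℓ) → ColouredGraph (Refinement V S)
inducedᶜ (G , χ) S = induced G S , record
  { colour     = colour χ
  ; colour-sym = colour-sym χ
  }

Pattern : Set₁
Pattern = ∃ λ k → ColouredGraph (Fin k)

Free : List Pattern → ∀ {V} → ColouredGraph V → Set₁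
Free 𝓕 {V} G = ∀ {k P} → (k , P) ∈ 𝓕 → ¬ (∃ λ (S : Pred V 0ℓ) → inducedᶜ G S ≅ᶜ P)

AdmitsFree : ∀ {V} → SimpleGraph V → List Pattern → Set₁
AdmitsFree G 𝓕 = ∃ λ (χ : Colouring G) → Free 𝓕 (G , χ)

------------------------------------------------------------------------
-- Patterns on three vertices

-- The path 0 - 1 - 2.
path₃ : SimpleGraph (Fin 3)
path₃ = record
  { Adj        = λ u v → Next u v ⊎ Next v u
  ; adj?       = λ u v → next? u v ⊎-dec next? v u
  ; adj-sym    = Sum.swap
  ; adj-irrefl = λ { refl → [ ℕ.1+n≢n , ℕ.1+n≢n ]′ }
  }
  where
  Next : Rel (Fin 3) 0ℓ
  Next u v = ℕ.suc (toℕ u) ≡ toℕ v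

  next? : Binary.Decidable Next
  next? u v = ℕ.suc (toℕ u) ℕ.≟ toℕ v

complete₃ : SimpleGraph (Fin 3)
complete₃ = record
  { Adj        = _≢_
  ; adj?       = λ u v → ¬? (u ≟ v)
  ; adj-sym    = ≢-sym
  ; adj-irrefl = λ u≡v u≢v → u≢v u≡v
  }

monoP₃ : Colour → Pattern
monoP₃ c = 3 , (path₃ , record { colour = λ _ → c ; colour-sym = λ _ _ → refl })

-- colouredK₃ a b c gives the edges 01, 02 and 12 the colours a, b and c.
colouredK₃ : Colour → Colour → Colour → Pattern
colouredK₃ a b c = 3 , (complete₃ , record
  { colour     = λ {u} {v} → col u v
  ; colour-sym = λ {u} {v} → col-sym u v
  })
  where
  col : (u v : Fin 3) → u ≢ v → Colour
  col zero             zero             p = ⊥-elim (p refl)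
  col zero             (suc zero)       _ = a
  col zero             (suc (suc zero)) _ = b
  col (suc zero)       zero             _ = a
  col (suc zero)       (suc zero)       p = ⊥-elim (p refl)
  col (suc zero)       (suc (suc zero)) _ = c
  col (suc (suc zero)) zero             _ = b
  col (suc (suc zero)) (suc zero)       _ = c
  col (suc (suc zero)) (suc (suc zero)) p = ⊥-elim (p refl)

  col-sym : ∀ u v (p : u ≢ v) (q : v ≢ u) → col u v p ≡ col v u q
  col-sym zero             zero             p _ = ⊥-elim (p refl)
  col-sym zero             (suc zero)       _ _ = refl
  col-sym zero             (suc (suc zero)) _ _ = refl
  col-sym (suc zero)       zero             _ _ = refl
  col-sym (suc zero)       (suc zero)       p _ = ⊥-elim (p refl)
  col-sym (suc zero)       (suc (suc zero)) _ _ = refl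
  col-sym (suc (suc zero)) zero             _ _ = refl
  col-sym (suc (suc zero)) (suc zero)       _ _ = refl
  col-sym (suc (suc zero)) (suc (suc zero)) p _ = ⊥-elim (p refl)

ʳP₃ ᵇP₃ ʳK₃ ᵇK₃ ʳʳᵇK₃ ʳᵇᵇK₃ : Pattern
ʳP₃   = monoP₃ red
ᵇP₃   = monoP₃ blue
ʳK₃   = colouredK₃ red red red
ᵇK₃   = colouredK₃ blue blue blue
ʳʳᵇK₃ = colouredK₃ red red blue
ʳᵇᵇK₃ = colouredK₃ red blue blue

------------------------------------------------------------------------
-- Bipartite multigraphs and their line graphs

-- Distinct edges may have the same two ends.
record BipartiteMultigraph : Set where
  field
    ∣X∣ ∣Y∣ ∣E∣ : ℕ
    endX        : Fin ∣E∣ → Fin ∣X∣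
    endY        : Fin ∣E∣ → Fin ∣Y∣

  X Y E : Set
  X = Fin ∣X∣
  Y = Fin ∣Y∣
  E = Fin ∣E∣

  Incident : E → X ⊎ Y → Set
  Incident e (inj₁ x) = endX e ≡ x
  Incident e (inj₂ y) = endY e ≡ y

open BipartiteMultigraph public

subset : ∀ {n} {P : Pred (Fin n) 0ℓ} → Decidable P → Subset n
subset P? = tabulate (does ∘ P?)

edgesAt : (H : BipartiteMultigraph) → X H → Subset (∣E∣ H)
edgesAt H x = subset (λ e → endX H e ≟ x)

neighbours : (H : BipartiteMultigraph) → X H → Subset (∣Y∣ H)
neighbours H x = subset (λ y → any? (λ e → endX H e ≟ x ×-dec endY H e ≟ y))

NoParallelEdges : BipartiteMultigraph → Set
NoParallelEdges H = ∀ {e f} → endX H e ≡ endX H f → endY H e ≡ endY H f → e ≡ f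

IsIncidenceGraph : BipartiteMultigraph → Set
IsIncidenceGraph H = NoParallelEdges H × (∀ x → ∣ edgesAt H x ∣ ≤ 2)

IsIncidenceMultigraph : BipartiteMultigraph → Set
IsIncidenceMultigraph H = ∀ x → ∣ neighbours H x ∣ ≤ 2

lineGraph : (H : BipartiteMultigraph) → SimpleGraph (E H)
lineGraph H = record
  { Adj        = λ e f → e ≢ f × Meet e f
  ; adj?       = λ e f → ¬? (e ≟ f) ×-dec meet? e f
  ; adj-sym    = λ { (e≢f , v , ev , fv) → ≢-sym e≢f , v , fv , ev }
  ; adj-irrefl = λ { e≡f (e≢f , _) → e≢f e≡f }
  }
  where
  Meet : Rel (E H) 0ℓ
  Meet e f = ∃ λ v → Incident H e v × Incident H f v

  meet? : Binary.Decidable Meet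
  meet? e f = Dec.map′
    [ (λ eq → inj₁ (endX H f) , eq , refl) , (λ eq → inj₂ (endY H f) , eq , refl) ]′
    (λ { (inj₁ _ , refl , eq) → inj₁ (sym eq) ; (inj₂ _ , refl , eq) → inj₂ (sym eq) })
    (endX H e ≟ endX H f ⊎-dec endY H e ≟ endY H f)

------------------------------------------------------------------------
-- Augmentations

-- A graph on A ⊎ C, where A and C are cliques joined by at least one edge.
record CoBipartite : Set₁ where
  field
    ∣A∣ ∣C∣ : ℕ
    graph   : SimpleGraph (Fin ∣A∣ ⊎ Fin ∣C∣)
    cliqueA : ∀ {p q} → p ≢ q → Adj graph (inj₁ p) (inj₁ q)
    cliqueC : ∀ {p q} → p ≢ q → Adj graph (inj₂ p) (inj₂ q)
    A-C     : ∃ λ p → ∃ λ q → Adj graph (inj₁ p) (inj₂ q)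

  Vertex : Set
  Vertex = Fin ∣A∣ ⊎ Fin ∣C∣

module Co = CoBipartite

-- A matching x₁y₁, …, xₖyₖ of flat edges, and an augment for each of them.
record AugmentationData {V : Set} (G₀ : SimpleGraph V) : Set₁ where
  field
    k        : ℕ
    x y      : Fin k → V
    flat     : ∀ i → Flat G₀ (x i) (y i)
    matching : ∀ {i j} → i ≢ j → x i ≢ x j × x i ≢ y j × y i ≢ y j
    augment  : Fin k → CoBipartite

  Unmatched : Pred V 0ℓ
  Unmatched v = ∀ i → v ≢ x i × v ≢ y i

  Vertex : Set
  Vertex = Refinement V Unmatched ⊎ Σ (Fin k) (Co.Vertex ∘ augment)

  -- The vertices of Aᵢ replace xᵢ and those of Cᵢ replace yᵢ.
  origin : Vertex → V
  origin (inj₁ v)            = value v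
  origin (inj₂ (i , inj₁ _)) = x i
  origin (inj₂ (i , inj₂ _)) = y i

  -- Not both in the same augment.
  Apart : Rel Vertex 0ℓ
  Apart (inj₂ (i , _)) (inj₂ (j , _)) = i ≢ j
  Apart _              _              = ⊤

  -- All k edges are augmented at once.  Since the edges form a matching and
  -- unmatched vertices are not ends of them, outside joins Aᵢ precisely to
  -- what N(xᵢ) ∖ {yᵢ} has become, and Cᵢ to what N(yᵢ) ∖ {xᵢ} has become.
  data AugAdj : Rel Vertex 0ℓ where
    inside  : ∀ {i p q} → Adj (Co.graph (augment i)) p q → AugAdj (inj₂ (i , p)) (inj₂ (i , q))
    outside : ∀ {u v} → Apart u v → Adj G₀ (origin u) (origin v) → AugAdj u v

  private
    apart-sym : ∀ u v → Apart u v → Apart v u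
    apart-sym (inj₁ _) (inj₁ _) _   = tt
    apart-sym (inj₁ _) (inj₂ _) _   = tt
    apart-sym (inj₂ _) (inj₁ _) _   = tt
    apart-sym (inj₂ _) (inj₂ _) i≢j = ≢-sym i≢j

    outside? : ∀ u v → Apart u v → (∀ {i p q} → u ≡ inj₂ (i , p) → v ≢ inj₂ (i , q)) →
               Dec (AugAdj u v)
    outside? u v apart separate = Dec.map′ (outside apart) unwrap (adj? G₀ (origin u) (origin v))
      where
      unwrap : AugAdj u v → Adj G₀ (origin u) (origin v)
      unwrap (inside _)    = ⊥-elim (separate refl refl)
      unwrap (outside _ a) = a

    augAdj? : Binary.Decidable AugAdj
    augAdj? u@(inj₁ _) v@(inj₁ _) = outside? u v tt λ ()
    augAdj? u@(inj₁ _) v@(inj₂ _) = outside? u v tt λ ()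
    augAdj? u@(inj₂ _) v@(inj₁ _) = outside? u v tt λ _ ()
    augAdj? u@(inj₂ (i , p)) v@(inj₂ (j , q)) with i ≟ j
    ... | no i≢j = outside? u v i≢j λ { refl refl → i≢j refl }
    ... | yes refl = Dec.map′ inside unwrap (adj? (Co.graph (augment i)) p q)
      where
      unwrap : AugAdj u v → Adj (Co.graph (augment i)) p q
      unwrap (inside a)      = a
      unwrap (outside i≢i _) = ⊥-elim (i≢i refl)

  augmented : SimpleGraph Vertex
  augmented = record
    { Adj        = AugAdj
    ; adj?       = augAdj?
    ; adj-sym    = λ
      { (inside {i} a)        → inside (adj-sym (Co.graph (augment i)) a)
      ; (outside {u} {v} d a) → outside (apart-sym u v d) (adj-sym G₀ a)
      }
    ; adj-irrefl = λ
      { refl (inside {i} a) → adj-irrefl (Co.graph (augment i)) refl a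
      ; refl (outside _ a)  → adj-irrefl G₀ refl a
      }
    }

IsXAugmentation : ∀ {V} → SimpleGraph V → BipartiteMultigraph → Set₁
IsXAugmentation G H =
  ∃ λ (D : AugmentationData (lineGraph H)) → let open AugmentationData D in
    (∀ i → ∃ λ (v : X H) → Incident H (x i) (inj₁ v) × Incident H (y i) (inj₁ v))
    × G ≅ augmented

{-# OPTIONS --safe #-}
module Submission where

-- Each condition is equivalent to the existence of a partition of the vertices
-- into cliques such that every vertex has neighbours in at most one class other
-- than its own.
--
-- Giving one colour to the edges within the classes and the other colour to the
-- edges between them yields colourings as in (1)–(4).  Conversely, in a
-- colouring without monochromatic induced P₃ and without triangle of colour d,
-- a triangle with exactly one edge of colour d contains two closed twins.  So
-- if the colours are copied from one representative of each class of closed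
-- twins, and twins are joined by the other colour, then that other colour
-- is transitive and its components are the required classes.
--
-- Given the partition, let Y consist of the classes.  The vertices of a class c
-- with a neighbour in another class d form, together with those of d with a
-- neighbour in c, an augment of two edges of H that end in c and d and share
-- their end in X.  The other vertices are pendant edges of H.  Conversely, the
-- vertices of an X-augmentation are partitioned by the ends in Y of the edges
-- of H that they come from.

open import Defs
open import Level using (0ℓ)
open import Data.Nat.Base as ℕ using (ℕ; suc; s≤s)
open import Data.Bool.Base using (if_then_else_)
open import Data.Empty using (⊥-elim; ⊥-elim-irr)
open import Data.Fin.Base using (Fin; zero; suc; join; splitAt; _<_)
import Data.Fin.Base as Fin
open import Data.Fin.Patterns using (0F; 1F; 2F)
open import Data.Fin.Properties
  using (any?; all?; _≟_; _<?_; suc-injective; ≤-antisym; <-cmp; <-irrefl; <-asym; pigeonhole; splitAt-join)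
open import Data.Fin.Subset using (∣_∣)
open import Data.Irrelevant using ([_])
open import Data.List.Base using (_∷_; [])
open import Data.List.Membership.Propositional.Properties using (∈-++⁺ˡ)
open import Data.List.Relation.Unary.Any using (here; there)
open import Data.Product.Base using (Σ; ∃; _×_; _,_; proj₁; proj₂; map₂; swap)
open import Data.Refinement using (Refinement; value; value-injective; _,_)
open import Data.Sum.Base as Sum using (_⊎_; inj₁; inj₂)
open import Data.Sum.Properties using (inj₁-injective; inj₂-injective)
open import Data.Unit.Base using (tt)
open import Function.Base using (_∘_)
open import Function.Bundles using (_⇔_; mk⇔; mk↔ₛ′; Equivalence; Inverse)
open import Function.Definitions using (Injective)
open import Relation.Binary.Core using (Rel)
open import Relation.Binary.Definitions using (DecidableEquality; tri<; tri≈; tri>)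
open import Relation.Binary.Structures using (IsDecEquivalence)
open import Relation.Binary.PropositionalEquality
  using (_≡_; _≢_; refl; sym; trans; cong; subst; subst₂; ≢-sym)
open import Relation.Nullary
  using (¬_; Dec; yes; no; does; contradiction; recompute; _×-dec_; _⊎-dec_; _→-dec_)
import Relation.Nullary.Decidable as Dec
open import Relation.Unary using (Pred; Decidable)

-- Finite sets

-- Passes between the cardinality of a decidable subset and its elements, and indexes sets of
-- vertices by `Fin size`.
record Enumeration {n} (P : Pred (Fin n) 0ℓ) (size : ℕ) : Set where
  field
    element    : Fin size → Fin n
    element-∈  : ∀ i → P (element i)
    injective  : Injective _≡_ _≡_ element
    surjective : ∀ {v} → P v → ∃ λ i → element i ≡ v

open Enumeration

enumerate : ∀ {n} {P : Pred (Fin n) 0ℓ} (P? : Decidable P) → Enumeration P ∣ subset P? ∣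
enumerate {ℕ.zero} P? = record
  { element = λ () ; element-∈ = λ () ; injective = λ {} ; surjective = λ {} }
enumerate {suc n} {P} P? with P? zero | enumerate (P? ∘ suc)
... | no ¬p | rest = record
  { element    = suc ∘ element rest
  ; element-∈  = element-∈ rest
  ; injective  = injective rest ∘ suc-injective
  ; surjective = λ { {zero} p → contradiction p ¬p
                   ; {suc v} p → map₂ (cong suc) (surjective rest p) }
  }
... | yes p | rest = record
  { element    = elem
  ; element-∈  = λ { zero → p ; (suc i) → element-∈ rest i }
  ; injective  = inj
  ; surjective = λ { {zero} _ → zero , refl
                   ; {suc v} q → let i , eq = surjective rest q in suc i , cong suc eq }
  }
  where
  elem : Fin (suc _) → Fin (suc n)
  elem zero    = zero
  elem (suc i) = suc (element rest i)

  inj : Injective _≡_ _≡_ elem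
  inj {zero}  {zero}  _  = refl
  inj {zero}  {suc _} ()
  inj {suc _} {zero}  ()
  inj {suc i} {suc j} eq = cong suc (injective rest (suc-injective eq))

TwoCoincide : ∀ {A : Set} → A → A → A → Set
TwoCoincide a b c = a ≡ b ⊎ a ≡ c ⊎ b ≡ c

module _ {n} {P : Pred (Fin n) 0ℓ} (P? : Decidable P) where

  AtMostTwo : Set
  AtMostTwo = ∀ {a b c} → P a → P b → P c → TwoCoincide a b c

  size≤2⇒atMostTwo : ∣ subset P? ∣ ℕ.≤ 2 → AtMostTwo
  size≤2⇒atMostTwo size≤2 {a} {b} {c} pa pb pc = coincidence (pigeonhole (s≤s size≤2) index)
    where
    index : Fin 3 → Fin ∣ subset P? ∣
    index 0F = proj₁ (surjective (enumerate P?) pa)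
    index 1F = proj₁ (surjective (enumerate P?) pb)
    index 2F = proj₁ (surjective (enumerate P?) pc)

    same : ∀ {u v} (pu : P u) (pv : P v) →
           proj₁ (surjective (enumerate P?) pu) ≡ proj₁ (surjective (enumerate P?) pv) → u ≡ v
    same pu pv eq = trans (sym (proj₂ (surjective (enumerate P?) pu)))
      (trans (cong (element (enumerate P?)) eq) (proj₂ (surjective (enumerate P?) pv)))

    coincidence : (∃ λ i → ∃ λ j → i < j × index i ≡ index j) → TwoCoincide a b c
    coincidence (0F , 1F , _ , eq) = inj₁ (same pa pb eq)
    coincidence (0F , 2F , _ , eq) = inj₂ (inj₁ (same pa pc eq))
    coincidence (1F , 2F , _ , eq) = inj₂ (inj₂ (same pb pc eq))
    coincidence (0F , 0F , () , _)
    coincidence (1F , 0F , () , _)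
    coincidence (1F , 1F , s≤s () , _)
    coincidence (2F , 0F , () , _)
    coincidence (2F , 1F , s≤s () , _)
    coincidence (2F , 2F , s≤s (s≤s ()) , _)

  atMostTwo⇒size≤2 : AtMostTwo → ∣ subset P? ∣ ℕ.≤ 2
  atMostTwo⇒size≤2 atMostTwo = bound (enumerate P?)
    where
    -- With the size as a variable, cases on it are possible; a third element would contradict
    -- injectivity.
    bound : ∀ {m} → Enumeration P m → m ℕ.≤ 2
    bound {0} _ = ℕ.z≤n
    bound {1} _ = s≤s ℕ.z≤n
    bound {2} _ = s≤s (s≤s ℕ.z≤n)
    bound {suc (suc (suc _))} e
      with atMostTwo (element-∈ e 0F) (element-∈ e 1F) (element-∈ e 2F)
    ... | inj₁ eq        = contradiction (injective e eq) λ ()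
    ... | inj₂ (inj₁ eq) = contradiction (injective e eq) λ ()
    ... | inj₂ (inj₂ eq) = contradiction (injective e eq) λ ()

least : ∀ {n} {P : Pred (Fin n) 0ℓ} → Decidable P → ∃ P →
        ∃ λ i → P i × (∀ {j} → P j → i Fin.≤ j)
least {suc n} P? (i , pi) with P? zero
... | yes p = zero , p , λ _ → ℕ.z≤n
least {suc n} P? (zero , p₀) | no ¬p = contradiction p₀ ¬p
least {suc n} P? (suc i , pi) | no ¬p with least (P? ∘ suc) (i , pi)
... | j , pj , min = suc j , pj , λ { {zero} p → contradiction p ¬p ; {suc _} p → s≤s (min p) }

-- Canonical representatives of equivalence classes

module Representatives {n} {_~_ : Rel (Fin n) 0ℓ} (~-isDecEquivalence : IsDecEquivalence _~_) where
  private
    module ~ = IsDecEquivalence ~-isDecEquivalence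

    abstract
      leastRelated : ∀ u → ∃ λ v → (u ~ v) × (∀ {w} → u ~ w → v Fin.≤ w)
      leastRelated u = least (u ~.≟_) (u , ~.refl)

  rep : Fin n → Fin n
  rep u = proj₁ (leastRelated u)

  ~-rep : ∀ u → u ~ rep u
  ~-rep u = proj₁ (proj₂ (leastRelated u))

  -- Both representatives are least in the same class, so each bounds the other.
  rep-cong : ∀ {u v} → u ~ v → rep u ≡ rep v
  rep-cong {u} {v} u~v = ≤-antisym
    (proj₂ (proj₂ (leastRelated u)) (~.trans u~v (~-rep v)))
    (proj₂ (proj₂ (leastRelated v)) (~.trans (~.sym u~v) (~-rep u)))

  rep-injective : ∀ {u v} → rep u ≡ rep v → u ~ v
  rep-injective {u} {v} eq = ~.trans (~-rep u) (subst (_~ v) (sym eq) (~.sym (~-rep v)))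

  rep-idem : ∀ u → rep (rep u) ≡ rep u
  rep-idem u = sym (rep-cong (~-rep u))

-- Occurrences of patterns

_≟ᶜ_ : DecidableEquality Colour
red  ≟ᶜ red  = yes refl
red  ≟ᶜ blue = no λ ()
blue ≟ᶜ red  = no λ ()
blue ≟ᶜ blue = yes refl

opposite : Colour → Colour
opposite red  = blue
opposite blue = red

≢-opposite : ∀ c → c ≢ opposite c
≢-opposite red  ()
≢-opposite blue ()

≢⇒≡-opposite : ∀ {c d} → c ≢ d → c ≡ opposite d
≢⇒≡-opposite {red}  {red}  c≢d = contradiction refl c≢d
≢⇒≡-opposite {red}  {blue} _   = refl
≢⇒≡-opposite {blue} {red}  _   = refl
≢⇒≡-opposite {blue} {blue} c≢d = contradiction refl c≢d

colour-cong : ∀ {V} {G : SimpleGraph V} (χ : Colouring G) {u u′ v v′} → u ≡ u′ → v ≡ v′ →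
              (p : Adj G u v) (q : Adj G u′ v′) → colour χ p ≡ colour χ q
colour-cong {G = G} χ refl refl p q =
  trans (colour-sym χ p (adj-sym G p)) (colour-sym χ (adj-sym G p) q)

Contains : ∀ {V} → ColouredGraph V → Pattern → Set₁
Contains {V} G (k , P) = ∃ λ (S : Pred V 0ℓ) → inducedᶜ G S ≅ᶜ P

-- An induced copy in terms of a map of vertices, which is easier to build and to inspect than an
-- isomorphism from a refinement.
record Occurrence {k V} (P : ColouredGraph (Fin k)) (G : ColouredGraph V) : Set where
  field
    vertex           : Fin k → V
    vertex-injective : Injective _≡_ _≡_ vertex
    adj-iff          : ∀ i j → Adj (graph P) i j ⇔ Adj (graph G) (vertex i) (vertex j)
    same-colour      : ∀ i j (p : Adj (graph P) i j) (q : Adj (graph G) (vertex i) (vertex j)) →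
                       colour (colouring P) p ≡ colour (colouring G) q

open Occurrence

occurrence⇒contains : ∀ {k V} → DecidableEquality V → {P : ColouredGraph (Fin k)}
                      {G : ColouredGraph V} → Occurrence P G → Contains G (k , P)
occurrence⇒contains {k} {V} _≟ⱽ_ {P} {G} occ = S , record
  { iso = record
    { bijection = mk↔ₛ′ to (λ j → vertex occ j , [ j , refl ])
        (λ j → vertex-injective occ (vertex-to (vertex occ j , [ j , refl ])))
        (value-injective ∘ vertex-to)
    ; adj⇔ = λ u v → mk⇔
        (Equivalence.from (adj-iff occ (to u) (to v)) ∘ lift u v)
        (subst₂ (Adj (graph G)) (vertex-to u) (vertex-to v)
          ∘ Equivalence.to (adj-iff occ (to u) (to v)))
    }
  ; colour≡ = λ {u} {v} p → trans (same-colour occ (to u) (to v) _ (lift u v p))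
      (colour-cong (colouring G) (vertex-to u) (vertex-to v) _ _)
  }
  where
  S : Pred V 0ℓ
  S v = ∃ λ j → vertex occ j ≡ v

  -- The membership proof in a refinement is irrelevant, so the pattern vertex is found again by a
  -- finite search.
  preimage : (v : Refinement V S) → S (value v)
  preimage (v , [ s ]) = recompute (any? λ j → vertex occ j ≟ⱽ v) s

  to : Refinement V S → Fin k
  to = proj₁ ∘ preimage

  vertex-to : ∀ v → vertex occ (to v) ≡ value v
  vertex-to = proj₂ ∘ preimage

  lift : ∀ u v → Adj (graph G) (value u) (value v) →
         Adj (graph G) (vertex occ (to u)) (vertex occ (to v))
  lift u v = subst₂ (Adj (graph G)) (sym (vertex-to u)) (sym (vertex-to v))

contains⇒occurrence : ∀ {k V} {P : ColouredGraph (Fin k)} {G : ColouredGraph V} →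
                      Contains G (k , P) → Occurrence P G
contains⇒occurrence {P = P} {G} (S , ι) = record
  { vertex           = value ∘ from
  ; vertex-injective = λ {i} {j} eq →
      trans (sym (to-from i)) (trans (cong to (value-injective eq)) (to-from j))
  ; adj-iff          = λ i j → mk⇔
      (λ a → Equivalence.from (adj⇔ (iso ι) (from i) (from j))
        (subst₂ (Adj (graph P)) (sym (to-from i)) (sym (to-from j)) a))
      (λ a → subst₂ (Adj (graph P)) (to-from i) (to-from j)
        (Equivalence.to (adj⇔ (iso ι) (from i) (from j)) a))
  ; same-colour      = λ i j p q → trans
      (colour-cong (colouring P) (sym (to-from i)) (sym (to-from j)) p _)
      (colour≡ ι q)
  }
  where
  open Inverse (bijection (iso ι)) using (to; from) renaming (strictlyInverseˡ to to-from)

module _ {V : Set} {G : SimpleGraph V} (χ : Colouring G) where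

  -- Only the ends have to be assumed distinct, since the other two pairs are adjacent.
  record MonoPath (c : Colour) : Set where
    constructor monoPath
    field
      {a b d}    : V
      ab         : Adj G a b
      bd         : Adj G b d
      a≢d        : a ≢ d
      ¬ad        : ¬ Adj G a d
      colour-ab  : colour χ ab ≡ c
      colour-bd  : colour χ bd ≡ c

  record Triangle (x y z : Colour) : Set where
    constructor triangle
    field
      {a b d}    : V
      ab         : Adj G a b
      ad         : Adj G a d
      bd         : Adj G b d
      colour-ab  : colour χ ab ≡ x
      colour-ad  : colour χ ad ≡ y
      colour-bd  : colour χ bd ≡ z

  contains⇒monoPath : ∀ {c} → Contains (G , χ) (monoP₃ c) → MonoPath c
  contains⇒monoPath contains = monoPath ab bd
    (λ eq → contradiction (vertex-injective occ eq) λ ())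
    (λ ad → contradiction (Equivalence.from (adj-iff occ 0F 2F) ad) λ { (inj₁ ()) ; (inj₂ ()) })
    (sym (same-colour occ 0F 1F (inj₁ refl) ab))
    (sym (same-colour occ 1F 2F (inj₁ refl) bd))
    where
    occ : Occurrence (proj₂ (monoP₃ _)) (G , χ)
    occ = contains⇒occurrence contains
    ab = Equivalence.to (adj-iff occ 0F 1F) (inj₁ refl)
    bd = Equivalence.to (adj-iff occ 1F 2F) (inj₁ refl)

  contains⇒triangle : ∀ {x y z} → Contains (G , χ) (colouredK₃ x y z) → Triangle x y z
  contains⇒triangle contains = triangle ab ad bd
    (sym (same-colour occ 0F 1F (λ ()) ab))
    (sym (same-colour occ 0F 2F (λ ()) ad))
    (sym (same-colour occ 1F 2F (λ ()) bd))
    where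
    occ : Occurrence (proj₂ (colouredK₃ _ _ _)) (G , χ)
    occ = contains⇒occurrence contains
    ab = Equivalence.to (adj-iff occ 0F 1F) λ ()
    ad = Equivalence.to (adj-iff occ 0F 2F) λ ()
    bd = Equivalence.to (adj-iff occ 1F 2F) λ ()

  module _ (_≟ⱽ_ : DecidableEquality V) where

    private
      adj⇒≢ : ∀ {u v} → Adj G u v → u ≢ v
      adj⇒≢ p u≡v = adj-irrefl G u≡v p

    monoPath⇒contains : ∀ {c} → MonoPath c → Contains (G , χ) (monoP₃ c)
    monoPath⇒contains {c} (monoPath {a} {b} {d} ab bd a≢d ¬ad ab-c bd-c) =
      occurrence⇒contains _≟ⱽ_ {proj₂ (monoP₃ c)} {G , χ} record
        { vertex           = ver
        ; vertex-injective = λ {i} {j} → inj i j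
        ; adj-iff          = λ i j → mk⇔ (to i j) (from i j)
        ; same-colour      = λ i j p q → sym (col i j p q)
        }
      where
      ver : Fin 3 → V
      ver 0F = a
      ver 1F = b
      ver 2F = d

      inj : ∀ i j → ver i ≡ ver j → i ≡ j
      inj 0F 0F _  = refl
      inj 0F 1F eq = contradiction eq (adj⇒≢ ab)
      inj 0F 2F eq = contradiction eq a≢d
      inj 1F 0F eq = contradiction (sym eq) (adj⇒≢ ab)
      inj 1F 1F _  = refl
      inj 1F 2F eq = contradiction eq (adj⇒≢ bd)
      inj 2F 0F eq = contradiction (sym eq) a≢d
      inj 2F 1F eq = contradiction (sym eq) (adj⇒≢ bd)
      inj 2F 2F _  = refl

      to : ∀ i j → Adj path₃ i j → Adj G (ver i) (ver j)
      to 0F 0F p = ⊥-elim (adj-irrefl path₃ {0F} refl p)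
      to 0F 1F _ = ab
      to 0F 2F (inj₁ ())
      to 0F 2F (inj₂ ())
      to 1F 0F _ = adj-sym G ab
      to 1F 1F p = ⊥-elim (adj-irrefl path₃ {1F} refl p)
      to 1F 2F _ = bd
      to 2F 0F (inj₁ ())
      to 2F 0F (inj₂ ())
      to 2F 1F _ = adj-sym G bd
      to 2F 2F p = ⊥-elim (adj-irrefl path₃ {2F} refl p)

      from : ∀ i j → Adj G (ver i) (ver j) → Adj path₃ i j
      from 0F 0F p = ⊥-elim (adj-irrefl G refl p)
      from 0F 1F _ = inj₁ refl
      from 0F 2F p = contradiction p ¬ad
      from 1F 0F _ = inj₂ refl
      from 1F 1F p = ⊥-elim (adj-irrefl G refl p)
      from 1F 2F _ = inj₁ refl
      from 2F 0F p = contradiction (adj-sym G p) ¬ad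
      from 2F 1F _ = inj₂ refl
      from 2F 2F p = ⊥-elim (adj-irrefl G refl p)

      col : ∀ i j → Adj path₃ i j → (q : Adj G (ver i) (ver j)) → colour χ q ≡ c
      col 0F 0F p _ = ⊥-elim (adj-irrefl path₃ {0F} refl p)
      col 0F 1F _ q = trans (colour-cong χ refl refl q ab) ab-c
      col 0F 2F (inj₁ ())
      col 0F 2F (inj₂ ())
      col 1F 0F _ q = trans (colour-sym χ q ab) ab-c
      col 1F 1F p _ = ⊥-elim (adj-irrefl path₃ {1F} refl p)
      col 1F 2F _ q = trans (colour-cong χ refl refl q bd) bd-c
      col 2F 0F (inj₁ ())
      col 2F 0F (inj₂ ())
      col 2F 1F _ q = trans (colour-sym χ q bd) bd-c
      col 2F 2F p _ = ⊥-elim (adj-irrefl path₃ {2F} refl p)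

    triangle⇒contains : ∀ {x y z} → Triangle x y z → Contains (G , χ) (colouredK₃ x y z)
    triangle⇒contains {x} {y} {z} (triangle {a} {b} {d} ab ad bd ab-x ad-y bd-z) =
      occurrence⇒contains _≟ⱽ_ {proj₂ (colouredK₃ x y z)} {G , χ} record
        { vertex           = ver
        ; vertex-injective = λ {i} {j} → inj i j
        ; adj-iff          = λ i j → mk⇔ (to i j)
            (λ p i≡j → adj-irrefl G (cong ver i≡j) p)
        ; same-colour      = λ i j p q → sym (col i j p q)
        }
      where
      ver : Fin 3 → V
      ver 0F = a
      ver 1F = b
      ver 2F = d

      to : ∀ i j → i ≢ j → Adj G (ver i) (ver j)
      to 0F 0F p = contradiction refl p
      to 0F 1F _ = ab
      to 0F 2F _ = ad
      to 1F 0F _ = adj-sym G ab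
      to 1F 1F p = contradiction refl p
      to 1F 2F _ = bd
      to 2F 0F _ = adj-sym G ad
      to 2F 1F _ = adj-sym G bd
      to 2F 2F p = contradiction refl p

      inj : ∀ i j → ver i ≡ ver j → i ≡ j
      inj i j eq = Dec.decidable-stable (i ≟ j) λ i≢j → adj⇒≢ (to i j i≢j) eq

      col : ∀ i j (p : i ≢ j) (q : Adj G (ver i) (ver j)) →
            colour χ q ≡ colour (colouring (proj₂ (colouredK₃ x y z))) {i} {j} p
      col 0F 0F p _ = contradiction refl p
      col 0F 1F _ q = trans (colour-cong χ refl refl q ab) ab-x
      col 0F 2F _ q = trans (colour-cong χ refl refl q ad) ad-y
      col 1F 0F _ q = trans (colour-sym χ q ab) ab-x
      col 1F 1F p _ = contradiction refl p
      col 1F 2F _ q = trans (colour-cong χ refl refl q bd) bd-z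
      col 2F 0F _ q = trans (colour-sym χ q ad) ad-y
      col 2F 1F _ q = trans (colour-sym χ q bd) bd-z
      col 2F 2F p _ = contradiction refl p

-- Clique partitions

record CliquePartition {V : Set} (G : SimpleGraph V) : Set where
  field
    {size} : ℕ
    class  : V → Fin size
    clique : ∀ {u v} → class u ≡ class v → u ≢ v → Adj G u v
    cross  : ∀ {u v w} → Adj G v u → Adj G v w → class v ≢ class u → class v ≢ class w →
             class u ≡ class w

-- Colourings from a clique partition

module FromPartition {V : Set} {G : SimpleGraph V} (Π : CliquePartition G) (c : Colour) where
  open CliquePartition Π

  -- Edges within classes receive `c`: red for statement (3), blue for (4).
  colouring-by-class : Colouring G
  colouring-by-class = record
    { colour     = λ {u} {v} _ → col (class u ≟ class v)
    ; colour-sym = λ {u} {v} _ _ → col-sym (class u ≟ class v) (class v ≟ class u)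
    }
    where
    col : ∀ {P : Set} → Dec P → Colour
    col d = if does d then c else opposite c

    col-sym : ∀ {i j : Fin size} (d : Dec (i ≡ j)) (e : Dec (j ≡ i)) → col d ≡ col e
    col-sym (yes _) (yes _) = refl
    col-sym (yes p) (no ¬p) = contradiction (sym p) ¬p
    col-sym (no ¬p) (yes p) = contradiction (sym p) ¬p
    col-sym (no _)  (no _)  = refl

  private
    χ = colouring-by-class

  same⇒ : ∀ {u v} (p : Adj G u v) → class u ≡ class v → colour χ p ≡ c
  same⇒ {u} {v} p eq with class u ≟ class v
  ... | yes _  = refl
  ... | no neq = contradiction eq neq

  distinct⇒ : ∀ {u v} (p : Adj G u v) → class u ≢ class v → colour χ p ≡ opposite c
  distinct⇒ {u} {v} p neq with class u ≟ class v
  ... | yes eq = contradiction eq neq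
  ... | no _   = refl

  ⇒same : ∀ {u v} (p : Adj G u v) → colour χ p ≡ c → class u ≡ class v
  ⇒same {u} {v} p eq = Dec.decidable-stable (class u ≟ class v) λ neq →
    ≢-opposite c (trans (sym eq) (distinct⇒ p neq))

  ⇒distinct : ∀ {u v} (p : Adj G u v) → colour χ p ≢ c → class u ≢ class v
  ⇒distinct p neq eq = neq (same⇒ p eq)

  -- The ends share a class in either case: by transitivity if both edges lie within classes, by
  -- `cross` at the middle vertex otherwise. Then `clique` makes them adjacent.
  noMonoPath : ∀ {d} → ¬ MonoPath χ d
  noMonoPath {d} (monoPath ab bd a≢d ¬ad ab-d bd-d) with d ≟ᶜ c
  ... | yes refl = ¬ad (clique (trans (⇒same ab ab-d) (⇒same bd bd-d)) a≢d)
  ... | no d≢c = ¬ad (clique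
    (cross (adj-sym G ab) bd (≢-sym (⇒distinct ab (d≢c ∘ trans (sym ab-d))))
      (⇒distinct bd (d≢c ∘ trans (sym bd-d)))) a≢d)

  -- By `cross` at `a`, the other two vertices share a class, so the edge between them has colour
  -- `c`.
  noOppositeTriangle : ∀ {d} → d ≢ c → ¬ Triangle χ d d d
  noOppositeTriangle d≢c (triangle ab ad bd ab-d ad-d bd-d) =
    ⇒distinct bd (d≢c ∘ trans (sym bd-d))
      (cross ab ad (⇒distinct ab (d≢c ∘ trans (sym ab-d))) (⇒distinct ad (d≢c ∘ trans (sym ad-d))))

  -- Two edges within classes force the third into the same class. This and `noTriangle-dcc` differ
  -- in the position of the odd edge, as `ʳʳᵇK₃` and `ʳᵇᵇK₃` do.
  noTriangle-ccd : ∀ {d} → d ≢ c → ¬ Triangle χ c c d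
  noTriangle-ccd d≢c (triangle ab ad bd ab-c ad-c bd-d) =
    ⇒distinct bd (d≢c ∘ trans (sym bd-d)) (trans (sym (⇒same ab ab-c)) (⇒same ad ad-c))

  noTriangle-dcc : ∀ {d} → d ≢ c → ¬ Triangle χ d c c
  noTriangle-dcc d≢c (triangle ab ad bd ab-d ad-c bd-c) =
    ⇒distinct ab (d≢c ∘ trans (sym ab-d)) (trans (⇒same ad ad-c) (sym (⇒same bd bd-c)))

-- A clique partition from a colouring

module FromColouring
  {n} {G : SimpleGraph (Fin n)} (χ : Colouring G) (d : Colour)
  (noMonoPath : ∀ {c} → ¬ MonoPath χ c) (noTriangle : ¬ Triangle χ d d d) where

  -- `Marked` edges have the colour `d` of the forbidden triangle. The classes will arise from
  -- `Plain` edges between twin representatives.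
  Marked Plain : Rel (Fin n) 0ℓ
  Marked u v = Σ (Adj G u v) λ p → colour χ p ≡ d
  Plain  u v = Σ (Adj G u v) λ p → colour χ p ≢ d

  marked-sym : ∀ {u v} → Marked u v → Marked v u
  marked-sym (p , eq) = adj-sym G p , trans (colour-sym χ _ p) eq

  plain-sym : ∀ {u v} → Plain u v → Plain v u
  plain-sym (p , neq) = adj-sym G p , λ eq → neq (trans (colour-sym χ p _) eq)

  marked-or-plain : ∀ {u v} → Adj G u v → Marked u v ⊎ Plain u v
  marked-or-plain p with colour χ p ≟ᶜ d
  ... | yes eq = inj₁ (p , eq)
  ... | no neq = inj₂ (p , neq)

  plain? : ∀ u v → Dec (Plain u v)
  plain? u v with adj? G u v
  ... | no ¬p = no (¬p ∘ proj₁)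
  ... | yes p with colour χ p ≟ᶜ d
  ...   | yes eq = no λ { (q , neq) → neq (trans (colour-cong χ refl refl q p) eq) }
  ...   | no neq = yes (p , neq)

  path-closes : ∀ {u v w} (p : Adj G u v) (q : Adj G v w) → colour χ p ≡ colour χ q → u ≢ w → Adj G u w
  path-closes {u} {v} {w} p q eq u≢w = Dec.decidable-stable (adj? G u w) λ ¬uw →
    noMonoPath (monoPath p q u≢w ¬uw eq refl)

  -- Plain edges share the one remaining colour. The third edge may still be marked, which is the
  -- only obstacle to transitivity.
  plain-plain : ∀ {u v w} → Plain u v → Plain v w → u ≢ w → Adj G u w
  plain-plain (p , p≢d) (q , q≢d) = path-closes p q
    (trans (≢⇒≡-opposite p≢d) (sym (≢⇒≡-opposite q≢d)))

  -- The third edge exists by `path-closes`; if marked, it would complete a triangle of colour `d`.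
  marked-marked : ∀ {u v w} → Marked u v → Marked v w → u ≢ w → Plain u w
  marked-marked (p , p≡d) (q , q≡d) u≢w = uw , λ eq → noTriangle (triangle p uw q p≡d eq q≡d)
    where uw = path-closes p q (trans p≡d (sym q≡d)) u≢w

  -- Closed neighbourhoods and twins

  _∈N[_] : Rel (Fin n) 0ℓ
  w ∈N[ u ] = u ≡ w ⊎ Adj G u w

  _∈N[_]? : ∀ w u → Dec (w ∈N[ u ])
  w ∈N[ u ]? = u ≟ w ⊎-dec adj? G u w

  ∈N-sym : ∀ {u w} → w ∈N[ u ] → u ∈N[ w ]
  ∈N-sym (inj₁ eq) = inj₁ (sym eq)
  ∈N-sym (inj₂ p)  = inj₂ (adj-sym G p)

  ∈N⇒adj : ∀ {u w} → w ∈N[ u ] → u ≢ w → Adj G u w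
  ∈N⇒adj (inj₁ eq) u≢w = contradiction eq u≢w
  ∈N⇒adj (inj₂ p)  _   = p

  _⊑_ : Rel (Fin n) 0ℓ
  u ⊑ v = ∀ x → x ∈N[ u ] → x ∈N[ v ]

  Twins : Rel (Fin n) 0ℓ
  Twins u v = u ⊑ v × v ⊑ u

  _⊑?_ : ∀ u v → Dec (u ⊑ v)
  u ⊑? v = all? λ x → x ∈N[ u ]? →-dec x ∈N[ v ]?

  twins-isDecEquivalence : IsDecEquivalence Twins
  twins-isDecEquivalence = record
    { isEquivalence = record
      { refl  = (λ _ p → p) , (λ _ p → p)
      ; sym   = λ (p , q) → q , p
      ; trans = λ (p , q) (p′ , q′) → (λ x → p′ x ∘ p x) , (λ x → q x ∘ q′ x)
      }
    ; _≟_ = λ u v → u ⊑? v ×-dec v ⊑? u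
    }

  -- Let `x` be a further neighbour of `w`. If `wx` is plain, the path `v w x` closes. If it is
  -- marked, `ux` is plain by `marked-marked` and the path `v u x` closes.
  plain-plain-marked⇒⊑ : ∀ {u v w} → Plain u v → Plain v w → Marked u w → w ⊑ v
  plain-plain-marked⇒⊑ uv vw uw x (inj₁ refl) = inj₂ (proj₁ vw)
  plain-plain-marked⇒⊑ {u} {v} {w} uv vw uw x (inj₂ wx) with v ≟ x | u ≟ x | marked-or-plain wx
  ... | yes v≡x | _        | _       = inj₁ v≡x
  ... | _       | yes refl | _       = inj₂ (adj-sym G (proj₁ uv))
  ... | no v≢x  | no u≢x   | inj₂ wx = inj₂ (plain-plain vw wx v≢x)
  ... | no v≢x  | no u≢x   | inj₁ wx =
    inj₂ (plain-plain (plain-sym uv) (marked-marked uw wx u≢x) v≢x)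

  -- Any z ∈ N[w] ∖ N[u] makes zv marked and zw plain, so the previous lemma
  -- applies to the triangle zwv as well as to uvw.
  plain-plain-marked⇒twins : ∀ {u v w} → Plain u v → Plain v w → Marked u w → ¬ (w ⊑ u) → Twins v w
  plain-plain-marked⇒twins {u} {v} {w} uv vw uw w⋢u = Dec.decidable-stable
    (IsDecEquivalence._≟_ twins-isDecEquivalence v w) λ ¬twins → w⋢u λ z z∈w →
      Dec.decidable-stable (z ∈N[ u ]?) λ z∉u →
        ¬twins (v⊑w z z∈w z∉u , plain-plain-marked⇒⊑ uv vw uw)
    where
    v⊑w : ∀ z → z ∈N[ w ] → ¬ z ∈N[ u ] → v ⊑ w
    v⊑w z (inj₁ refl) z∉u = contradiction (inj₂ (proj₁ uw)) z∉u
    v⊑w z (inj₂ wz)   z∉u with marked-or-plain wz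
    ... | inj₁ wz = contradiction (inj₂ (proj₁ (marked-marked uw wz (z∉u ∘ inj₁)))) z∉u
    ... | inj₂ wz with marked-or-plain (plain-plain vw wz λ { refl → z∉u (inj₂ (proj₁ uv)) })
    ...   | inj₁ vz = plain-plain-marked⇒⊑ (plain-sym wz) (plain-sym vw) (marked-sym vz)
    ...   | inj₂ vz = contradiction (inj₂ (plain-plain uv vz (z∉u ∘ inj₁))) z∉u

  -- Were `uw` marked, `plain-plain-marked⇒twins`, read from both ends, would make `v` a twin of `u`
  -- or of `w`, unless `u` and `w` had the same closed neighbourhood and were twins themselves.
  plain-trans : ∀ {u v w} → ¬ Twins u v → ¬ Twins v w → ¬ Twins u w →
                Plain u v → Plain v w → u ≢ w → Plain u w
  plain-trans {u} {v} {w} ¬uv ¬vw ¬uw uv vw u≢w with marked-or-plain (plain-plain uv vw u≢w)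
  ... | inj₂ p = p
  ... | inj₁ m = contradiction
    ( Dec.decidable-stable (u ⊑? w) (λ u⋢w → ¬uv (swap
        (plain-plain-marked⇒twins (plain-sym vw) (plain-sym uv) (marked-sym m) u⋢w)))
    , Dec.decidable-stable (w ⊑? u) (λ w⋢u → ¬vw (plain-plain-marked⇒twins uv vw m w⋢u))
    ) ¬uw

  open Representatives twins-isDecEquivalence renaming (rep to τ; ~-rep to twins-τ)
    using (rep-cong; rep-injective; rep-idem)

  -- Membership in closed neighbourhoods is carried over to twins at one end and then at the other.
  adj-τ : ∀ {u v} → Adj G u v → τ u ≢ τ v → Adj G (τ u) (τ v)
  adj-τ {u} {v} uv = ∈N⇒adj
    (∈N-sym (proj₁ (twins-τ v) _ (∈N-sym (proj₁ (twins-τ u) _ (inj₂ uv)))))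

  adj-of-τ : ∀ {u v} → Adj G (τ u) (τ v) → u ≢ v → Adj G u v
  adj-of-τ {u} {v} uv = ∈N⇒adj
    (∈N-sym (proj₂ (twins-τ v) _ (∈N-sym (proj₂ (twins-τ u) _ (inj₂ uv)))))

  -- The colours of the edges between twin representatives are copied to all
  -- vertices, and twins are joined by plain edges.
  _≈_ : Rel (Fin n) 0ℓ
  u ≈ v = τ u ≡ τ v ⊎ Plain (τ u) (τ v)

  -- Twin representatives coincide, whereas adjacency is irreflexive. This supplies hypotheses of
  -- `plain-trans`.
  τ-distinct : ∀ {u v} → Plain (τ u) (τ v) → ¬ Twins (τ u) (τ v)
  τ-distinct {u} {v} (p , _) twins =
    adj-irrefl G (trans (sym (rep-idem u)) (trans (rep-cong twins) (rep-idem v))) p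

  ≈-isDecEquivalence : IsDecEquivalence _≈_
  ≈-isDecEquivalence = record
    { isEquivalence = record
      { refl  = inj₁ refl
      ; sym   = λ { (inj₁ eq) → inj₁ (sym eq) ; (inj₂ p) → inj₂ (plain-sym p) }
      ; trans = ≈-trans
      }
    ; _≟_ = λ u v → τ u ≟ τ v ⊎-dec plain? (τ u) (τ v)
    }
    where
    ≈-trans : ∀ {u v w} → u ≈ v → v ≈ w → u ≈ w
    ≈-trans {u} {v} {w} (inj₁ eq) v≈w = subst (λ t → t ≡ τ w ⊎ Plain t (τ w)) (sym eq) v≈w
    ≈-trans {u} {v} {w} (inj₂ p) (inj₁ eq) = inj₂ (subst (Plain (τ u)) eq p)
    ≈-trans {u} {v} {w} (inj₂ p) (inj₂ q) with τ u ≟ τ w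
    ... | yes eq = inj₁ eq
    ... | no neq = inj₂ (plain-trans (τ-distinct p) (τ-distinct q)
      (λ t → neq (trans (sym (rep-idem u)) (trans (rep-cong t) (rep-idem w)))) p q neq)

  private
    module ≈ = IsDecEquivalence ≈-isDecEquivalence
    module Class = Representatives ≈-isDecEquivalence

  -- If the representatives were equal or joined by a plain edge, `u` and `v` would be related by
  -- `≈`.
  ≉⇒marked : ∀ {u v} → Adj G u v → Class.rep u ≢ Class.rep v → Marked (τ u) (τ v)
  ≉⇒marked {u} {v} uv neq with marked-or-plain (adj-τ uv (neq ∘ Class.rep-cong ∘ inj₁))
  ... | inj₁ m = m
  ... | inj₂ p = contradiction (Class.rep-cong (inj₂ p)) neq

  partition : CliquePartition G
  partition = record
    { class  = Class.rep
    ; clique = λ eq → clique (Class.rep-injective eq)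
    ; cross  = λ vu vw v≉u v≉w →
        Class.rep-cong (cross (marked-sym (≉⇒marked vu v≉u)) (≉⇒marked vw v≉w))
    }
    where
    clique : ∀ {u v} → u ≈ v → u ≢ v → Adj G u v
    -- Each of two twins lies in the closed neighbourhood of the other.
    clique {u} {v} (inj₁ eq) = ∈N⇒adj (proj₂ (rep-injective eq) _ (inj₁ refl))
    clique {u} {v} (inj₂ p)  = adj-of-τ (proj₁ p)

    cross : ∀ {u v w} → Marked (τ u) (τ v) → Marked (τ v) (τ w) → u ≈ w
    cross {u} {v} {w} uv vw with τ u ≟ τ w
    ... | yes eq = inj₁ eq
    -- Two marked edges at `τ v` close to a plain edge, which stays within a class.
    ... | no neq = inj₂ (marked-marked uv vw neq)

-- Augmentations

module _ {V : Set} {G₀ : SimpleGraph V} (D : AugmentationData G₀) where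
  open AugmentationData D

  -- Splits pairs of vertices as `AugAdj` does: `inside` governs adjacency in one augment, `outside`
  -- everything else.
  data Position : Vertex → Vertex → Set where
    together : ∀ i p q → Position (inj₂ (i , p)) (inj₂ (i , q))
    apart    : ∀ {a b} → Apart a b → Position a b

  position : ∀ a b → Position a b
  position (inj₁ _) (inj₁ _) = apart tt
  position (inj₁ _) (inj₂ _) = apart tt
  position (inj₂ _) (inj₁ _) = apart tt
  position (inj₂ (i , p)) (inj₂ (j , q)) with i ≟ j
  ... | yes refl = together i p q
  ... | no i≢j   = apart i≢j

  apart-sym : ∀ {a b} → Apart a b → Apart b a
  apart-sym {inj₁ _} {inj₁ _} _   = tt
  apart-sym {inj₁ _} {inj₂ _} _   = tt
  apart-sym {inj₂ _} {inj₁ _} _   = tt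
  apart-sym {inj₂ _} {inj₂ _} i≢j = ≢-sym i≢j

-- An augmentation from a clique partition

module ToAugmentation {n} {G : SimpleGraph (Fin n)} (Π : CliquePartition G) where
  open CliquePartition Π

  Cross : Rel (Fin n) 0ℓ
  Cross u v = Adj G u v × class u ≢ class v

  abstract
    crossNeighbour : ∀ v → ∃ λ u → Cross v u ⊎ (u ≡ v × (∀ w → ¬ Cross v w))
    crossNeighbour v with any? (λ u → adj? G v u ×-dec Dec.¬? (class v ≟ class u))
    ... | yes (u , c) = u , inj₁ c
    ... | no ¬c       = v , inj₂ (refl , λ w c → ¬c (w , c))

  -- When v has no neighbours in other classes, mate v = v and target v = class v.
  mate : Fin n → Fin n
  mate v = proj₁ (crossNeighbour v)

  target : Fin n → Fin size
  target v = class (mate v)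

  Matched : Pred (Fin n) 0ℓ
  Matched v = class v ≢ target v

  -- All cross neighbours of `v` lie in one class, so the target does not depend on which of them is
  -- the mate.
  cross⇒target : ∀ {v u} → Cross v u → target v ≡ class u
  cross⇒target {v} {u} (vu , v≢u) with crossNeighbour v
  ... | _ , inj₁ (vw , v≢w) = cross vw vu v≢w v≢u
  ... | _ , inj₂ (_ , none) = contradiction (vu , v≢u) (none u)

  cross-sym : ∀ {v u} → Cross v u → Cross u v
  cross-sym (vu , v≢u) = adj-sym G vu , ≢-sym v≢u

  matched⇒cross : ∀ {v} → Matched v → Cross v (mate v)
  matched⇒cross {v} m with crossNeighbour v
  ... | _ , inj₁ c          = c
  ... | _ , inj₂ (refl , _) = contradiction refl m

  unmatched⇒mate : ∀ {v} → class v ≡ target v → mate v ≡ v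
  unmatched⇒mate {v} eq with crossNeighbour v
  ... | _ , inj₁ (_ , v≢u) = contradiction eq v≢u
  ... | _ , inj₂ (u≡v , _) = u≡v

  -- A matched `v` is a cross neighbour of its mate, so passing to the mate swaps class and target.
  target-mate : ∀ v → target (mate v) ≡ class v
  target-mate v with class v ≟ target v
  ... | yes eq = trans (cong target (unmatched⇒mate eq)) (sym eq)
  ... | no m   = cross⇒target (cross-sym (matched⇒cross m))

  -- Each equivalence class becomes one edge of `H`. A side of an augment consists of the matched
  -- vertices with given class and target; unmatched vertices stay single even when they agree in
  -- both.
  _≈_ : Rel (Fin n) 0ℓ
  u ≈ v = u ≡ v ⊎ (class u ≡ class v × target u ≡ target v × Matched u)

  ≈-isDecEquivalence : IsDecEquivalence _≈_
  ≈-isDecEquivalence = record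
    { isEquivalence = record { refl = inj₁ refl ; sym = ≈-sym ; trans = ≈-trans }
    ; _≟_ = λ u v → u ≟ v ⊎-dec
        (class u ≟ class v ×-dec target u ≟ target v ×-dec Dec.¬? (class u ≟ target u))
    }
    where
    ≈-sym : ∀ {u v} → u ≈ v → v ≈ u
    ≈-sym (inj₁ eq) = inj₁ (sym eq)
    ≈-sym (inj₂ (c , t , m)) = inj₂ (sym c , sym t , λ eq → m (trans c (trans eq (sym t))))

    ≈-trans : ∀ {u v w} → u ≈ v → v ≈ w → u ≈ w
    ≈-trans (inj₁ refl) v≈w = v≈w
    ≈-trans u≈v (inj₁ refl) = u≈v
    ≈-trans (inj₂ (c , t , m)) (inj₂ (c′ , t′ , _)) = inj₂ (trans c c′ , trans t t′ , m)

  open Representatives ≈-isDecEquivalence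

  ≈-class : ∀ {u v} → u ≈ v → class u ≡ class v
  ≈-class (inj₁ refl)    = refl
  ≈-class (inj₂ (c , _)) = c

  ≈-target : ∀ {u v} → u ≈ v → target u ≡ target v
  ≈-target (inj₁ refl)        = refl
  ≈-target (inj₂ (_ , t , _)) = t

  ≈-mate : ∀ {u v} → u ≈ v → mate u ≈ mate v
  ≈-mate (inj₁ refl) = inj₁ refl
  ≈-mate {u} {v} (inj₂ (c , t , m)) = inj₂
    ( t
    , trans (target-mate u) (trans c (sym (target-mate v)))
    , λ eq → m (sym (trans eq (target-mate u)))
    )

  -- Only up to `≈`, because the mate of the mate may be another vertex on the same side as `v`.
  mate-mate : ∀ v → mate (mate v) ≈ v
  mate-mate v with class v ≟ target v
  ... | yes eq = inj₁ (trans (cong mate (unmatched⇒mate eq)) (unmatched⇒mate eq))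
  ... | no m   = inj₂
    ( target-mate v
    , target-mate (mate v)
    , λ eq → m (trans (sym (target-mate v)) (trans eq (target-mate (mate v))))
    )

  class-rep : ∀ v → class (rep v) ≡ class v
  class-rep v = sym (≈-class (~-rep v))

  target-rep : ∀ v → target (rep v) ≡ target v
  target-rep v = sym (≈-target (~-rep v))

  unmatched⇒rep : ∀ {v} → class v ≡ target v → rep v ≡ v
  unmatched⇒rep {v} eq with ~-rep v
  ... | inj₁ v≡r         = sym v≡r
  ... | inj₂ (_ , _ , m) = contradiction eq m

  -- Represents the opposite side of the augment. On representatives it is an involution whose fixed
  -- points are the unmatched vertices.
  partner : Fin n → Fin n
  partner v = rep (mate v)

  class-partner : ∀ v → class (partner v) ≡ target v
  class-partner v = class-rep (mate v)

  target-partner : ∀ v → target (partner v) ≡ class v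
  target-partner v = trans (target-rep (mate v)) (target-mate v)

  rep-partner : ∀ v → rep (partner v) ≡ partner v
  rep-partner v = rep-idem (mate v)

  partner-cong : ∀ {u v} → rep u ≡ rep v → partner u ≡ partner v
  partner-cong eq = rep-cong (≈-mate (rep-injective eq))

  partner-partner : ∀ v → partner (partner v) ≡ rep v
  partner-partner v = trans (partner-cong (rep-idem (mate v))) (rep-cong (mate-mate v))

  unmatched⇒partner : ∀ {v} → class v ≡ target v → partner v ≡ rep v
  unmatched⇒partner eq = cong rep (unmatched⇒mate eq)

  -- `v` has the class and the target of the mate of `u`. Hence edges between classes run only
  -- between the two sides of one augment.
  cross⇒partner : ∀ {u v} → Cross u v → rep v ≡ partner u
  cross⇒partner {u} {v} c@(uv , u≢v) = rep-cong (inj₂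
    ( sym (cross⇒target c)
    , trans (cross⇒target (cross-sym c)) (sym (target-mate u))
    , λ eq → u≢v (sym (trans eq (cross⇒target (cross-sym c))))
    ))

  -- Shared by v and its partner: it serves as the common end in X of the
  -- corresponding edges of H.
  anchor : Fin n → Fin n
  anchor v with target v <? class v
  ... | yes _ = partner v
  ... | no _  = rep v

  anchor-upper : ∀ {v} → target v < class v → anchor v ≡ partner v
  anchor-upper {v} lt with target v <? class v
  ... | yes _  = refl
  ... | no ¬lt = contradiction lt ¬lt

  anchor-lower : ∀ {v} → ¬ target v < class v → anchor v ≡ rep v
  anchor-lower {v} ¬lt with target v <? class v
  ... | yes lt = contradiction lt ¬lt
  ... | no _   = refl

  anchor-cases : ∀ v → anchor v ≡ rep v ⊎ anchor v ≡ partner v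
  anchor-cases v with target v <? class v
  ... | yes _ = inj₂ refl
  ... | no _  = inj₁ refl

  anchor-cong : ∀ {u v} → rep u ≡ rep v → anchor u ≡ anchor v
  anchor-cong {u} {v} eq with target u <? class u | target v <? class v
  ... | yes _  | yes _  = partner-cong eq
  ... | no _   | no _   = eq
  ... | yes lt | no ¬lt = contradiction (subst₂ _<_ (≈-target u≈v) (≈-class u≈v) lt) ¬lt
    where u≈v = rep-injective eq
  ... | no ¬lt | yes lt = contradiction (subst₂ _<_ (sym (≈-target u≈v)) (sym (≈-class u≈v)) lt) ¬lt
    where u≈v = rep-injective eq

  -- The anchor is whichever of `rep v` and `partner v` has the smaller class, and passing to the
  -- partner exchanges the two.
  anchor-partner : ∀ v → anchor (partner v) ≡ anchor v
  anchor-partner v with <-cmp (class v) (target v)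
  ... | tri≈ _ eq _ = anchor-cong (trans (rep-partner v) (unmatched⇒partner eq))
  ... | tri< lt _ ¬gt = trans
    (anchor-upper (subst₂ _<_ (sym (target-partner v)) (sym (class-partner v)) lt))
    (trans (partner-partner v) (sym (anchor-lower ¬gt)))
  ... | tri> ¬lt _ gt = trans
    (anchor-lower (¬lt ∘ subst₂ _<_ (target-partner v) (class-partner v)))
    (trans (rep-partner v) (sym (anchor-upper gt)))

  -- As `partner` is an involution on representatives, an anchor determines the pair of sides that
  -- share it.
  anchor-injective : ∀ {u v} → anchor u ≡ anchor v → rep u ≡ rep v ⊎ rep u ≡ partner v
  anchor-injective {u} {v} eq with anchor-cases u | anchor-cases v
  ... | inj₁ au | inj₁ av = inj₁ (trans (sym au) (trans eq av))
  ... | inj₁ au | inj₂ av = inj₂ (trans (sym au) (trans eq av))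
  ... | inj₂ au | inj₁ av = inj₂ (trans (sym (partner-partner u))
    (partner-cong (trans (rep-partner u) (trans (sym au) (trans eq av)))))
  ... | inj₂ au | inj₂ av = inj₁ (trans (sym (partner-partner u)) (trans
    (partner-cong (trans (rep-partner u) (trans (trans (sym au) (trans eq av)) (sym (rep-partner v)))))
    (partner-partner v)))

  -- Edges of `H` are the representatives. A pair of sides is named by the side of smaller class, so
  -- that each augment is counted once.
  IsEdge IsPair : Pred (Fin n) 0ℓ
  IsEdge v = rep v ≡ v
  IsPair v = IsEdge v × class v < target v

  isEdge? : Decidable IsEdge
  isEdge? v = rep v ≟ v

  isPair? : Decidable IsPair
  isPair? v = isEdge? v ×-dec class v <? target v

  edges : Enumeration IsEdge ∣ subset isEdge? ∣
  edges = enumerate isEdge?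

  pairs : Enumeration IsPair ∣ subset isPair? ∣
  pairs = enumerate isPair?

  -- All of `Fin n` serves as `X`; vertices that are not anchors are isolated.
  H : BipartiteMultigraph
  H = record
    { ∣X∣  = n
    ; ∣Y∣  = size
    ; ∣E∣  = ∣ subset isEdge? ∣
    ; endX = anchor ∘ element edges
    ; endY = class ∘ element edges
    }

  endX-injective : ∀ {e f} → endX H e ≡ endX H f →
                   e ≡ f ⊎ element edges e ≡ partner (element edges f)
  endX-injective {e} {f} eq with anchor-injective eq
  ... | inj₁ r≡r = inj₁ (injective edges
    (trans (sym (element-∈ edges e)) (trans r≡r (element-∈ edges f))))
  ... | inj₂ r≡p = inj₂ (trans (sym (element-∈ edges e)) r≡p)

  -- At one end in `X` there are only an edge and its partner. If these also had the same class,
  -- they would be unmatched and hence equal.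
  H-isIncidenceGraph : IsIncidenceGraph H
  H-isIncidenceGraph = noParallel , λ x → atMostTwo⇒size≤2 (λ e → endX H e ≟ x) degree
    where
    noParallel : NoParallelEdges H
    noParallel {e} {f} eqX eqY with endX-injective eqX
    ... | inj₁ e≡f = e≡f
    ... | inj₂ e≡p = injective edges (trans e≡p (trans
      (unmatched⇒partner (trans (sym eqY) (trans (cong class e≡p) (class-partner _))))
      (element-∈ edges f)))

    degree : ∀ {x e f g} → endX H e ≡ x → endX H f ≡ x → endX H g ≡ x → TwoCoincide e f g
    degree {e = e} ex fx gx with endX-injective (trans fx (sym ex)) | endX-injective (trans gx (sym ex))
    ... | inj₁ f≡e | _        = inj₁ (sym f≡e)
    ... | inj₂ _   | inj₁ g≡e = inj₂ (inj₁ (sym g≡e))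
    ... | inj₂ f≡p | inj₂ g≡p = inj₂ (inj₂ (injective edges (trans f≡p (sym g≡p))))

  lower : Fin ∣ subset isPair? ∣ → Fin n
  lower = element pairs

  rep-lower : ∀ i → rep (lower i) ≡ lower i
  rep-lower i = proj₁ (element-∈ pairs i)

  lower-< : ∀ i → class (lower i) < target (lower i)
  lower-< i = proj₂ (element-∈ pairs i)

  lower-matched : ∀ i → Matched (lower i)
  lower-matched i eq = <-irrefl eq (lower-< i)

  anchor-lower-vertex : ∀ i → anchor (lower i) ≡ lower i
  anchor-lower-vertex i = trans (anchor-lower (<-asym (lower-< i))) (rep-lower i)

  lowerEdge upperEdge : Fin ∣ subset isPair? ∣ → E H
  lowerEdge i = proj₁ (surjective edges (rep-lower i))
  upperEdge i = proj₁ (surjective edges (rep-partner (lower i)))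

  element-lowerEdge : ∀ i → element edges (lowerEdge i) ≡ lower i
  element-lowerEdge i = proj₂ (surjective edges (rep-lower i))

  element-upperEdge : ∀ i → element edges (upperEdge i) ≡ partner (lower i)
  element-upperEdge i = proj₂ (surjective edges (rep-partner (lower i)))

  endX-lowerEdge : ∀ i → endX H (lowerEdge i) ≡ lower i
  endX-lowerEdge i = trans (cong anchor (element-lowerEdge i)) (anchor-lower-vertex i)

  endX-upperEdge : ∀ i → endX H (upperEdge i) ≡ lower i
  endX-upperEdge i = trans (cong anchor (element-upperEdge i))
    (trans (anchor-partner (lower i)) (anchor-lower-vertex i))

  endY-lowerEdge : ∀ i → endY H (lowerEdge i) ≡ class (lower i)
  endY-lowerEdge i = cong class (element-lowerEdge i)

  endY-upperEdge : ∀ i → endY H (upperEdge i) ≡ target (lower i)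
  endY-upperEdge i = trans (cong class (element-upperEdge i)) (class-partner (lower i))

  endY-lower-upper : ∀ i → endY H (lowerEdge i) ≢ endY H (upperEdge i)
  endY-lower-upper i eq =
    lower-matched i (trans (sym (endY-lowerEdge i)) (trans eq (endY-upperEdge i)))

  at-lower : ∀ i {e} → endX H e ≡ lower i → e ≡ lowerEdge i ⊎ e ≡ upperEdge i
  at-lower i eq with endX-injective (trans eq (sym (endX-lowerEdge i)))
  ... | inj₁ e≡l = inj₁ e≡l
  ... | inj₂ e≡p = inj₂ (injective edges (trans e≡p
    (trans (cong partner (element-lowerEdge i)) (sym (element-upperEdge i)))))

  -- No third edge has `lower i` as its end in `X`, and no edge can meet both in `Y`, where their
  -- ends differ.
  lower-upper-flat : ∀ i → Flat (lineGraph H) (lowerEdge i) (upperEdge i)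
  lower-upper-flat i =
    ( endY-lower-upper i ∘ cong (endY H) , inj₁ (lower i) , endX-lowerEdge i , endX-upperEdge i )
    , λ w → noTriangle w
    where
    notAt : ∀ {e} → lowerEdge i ≢ e → upperEdge i ≢ e → endX H e ≢ lower i
    notAt l≢e u≢e eq with at-lower i eq
    ... | inj₁ e≡l = l≢e (sym e≡l)
    ... | inj₂ e≡u = u≢e (sym e≡u)

    noTriangle : ∀ w → ¬ (Adj (lineGraph H) (lowerEdge i) w × Adj (lineGraph H) (upperEdge i) w)
    noTriangle w ((l≢w , inj₁ _ , lx , wx) , u≢w , _) =
      notAt l≢w u≢w (trans wx (trans (sym lx) (endX-lowerEdge i)))
    noTriangle w ((l≢w , inj₂ _ , _ , _) , u≢w , inj₁ _ , ux , wx) =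
      notAt l≢w u≢w (trans wx (trans (sym ux) (endX-upperEdge i)))
    noTriangle w ((_ , inj₂ _ , ly , wy) , _ , inj₂ _ , uy , wy′) =
      endY-lower-upper i (trans ly (trans (sym wy) (trans wy′ (sym uy))))

  -- The augments

  inLower? : ∀ i → Decidable (λ w → rep w ≡ lower i)
  inLower? i w = rep w ≟ lower i

  inUpper? : ∀ i → Decidable (λ w → rep w ≡ partner (lower i))
  inUpper? i w = rep w ≟ partner (lower i)

  place : ∀ i → Fin ∣ subset (inLower? i) ∣ ⊎ Fin ∣ subset (inUpper? i) ∣ → Fin n
  place i (inj₁ p) = element (enumerate (inLower? i)) p
  place i (inj₂ p) = element (enumerate (inUpper? i)) p

  same-rep⇒class : ∀ {u v w} → rep u ≡ w → rep v ≡ w → class u ≡ class v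
  same-rep⇒class eq eq′ = ≈-class (rep-injective (trans eq (sym eq′)))

  augmentAt : Fin ∣ subset isPair? ∣ → CoBipartite
  augmentAt i = record
    { ∣A∣     = ∣ subset (inLower? i) ∣
    ; ∣C∣     = ∣ subset (inUpper? i) ∣
    ; graph   = record
      { Adj        = λ p q → Adj G (place i p) (place i q)
      ; adj?       = λ p q → adj? G (place i p) (place i q)
      ; adj-sym    = adj-sym G
      ; adj-irrefl = λ { refl → adj-irrefl G refl }
      }
    ; cliqueA = λ {p} {q} p≢q → clique
        (same-rep⇒class (element-∈ A p) (element-∈ A q)) (p≢q ∘ injective A)
    ; cliqueC = λ {p} {q} p≢q → clique
        (same-rep⇒class (element-∈ C p) (element-∈ C q)) (p≢q ∘ injective C)
    ; A-C     =
        let p , eqp = surjective A (rep-lower i)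
            -- `refl` selects `mate (lower i)`, which is represented by the partner by definition
            -- and is adjacent to `lower i`.
            q , eqq = surjective C refl
        in p , q , subst₂ (Adj G) (sym eqp) (sym eqq) (proj₁ (matched⇒cross (lower-matched i)))
    }
    where
    A = enumerate (inLower? i)
    C = enumerate (inUpper? i)

  D : AugmentationData (lineGraph H)
  D = record
    { k        = ∣ subset isPair? ∣
    ; x        = lowerEdge
    ; y        = upperEdge
    ; flat     = lower-upper-flat
    ; matching = λ {i} {j} i≢j →
        i≢j ∘ same-pair (endX-lowerEdge i) (endX-lowerEdge j)
      , i≢j ∘ same-pair (endX-lowerEdge i) (endX-upperEdge j)
      , i≢j ∘ same-pair (endX-upperEdge i) (endX-upperEdge j)
    ; augment  = augmentAt
    }
    where
    -- Both edges of pair `i` end in `lower i`, so an edge shared by two pairs identifies them.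
    same-pair : ∀ {i j e f} → endX H e ≡ lower i → endX H f ≡ lower j → e ≡ f → i ≡ j
    same-pair ei fj refl = injective pairs (trans (sym ei) fj)

  -- The isomorphism with the augmented line graph

  open AugmentationData D using (Vertex; Unmatched; origin; Apart; AugAdj; inside; outside; augmented)

  -- The inverse direction of the isomorphism.
  placed : Vertex → Fin n
  placed (inj₁ e)       = element edges (value e)
  placed (inj₂ (i , p)) = place i p

  rep-placed : ∀ a → rep (placed a) ≡ element edges (origin a)
  rep-placed (inj₁ e)            = element-∈ edges (value e)
  rep-placed (inj₂ (i , inj₁ p)) =
    trans (element-∈ (enumerate (inLower? i)) p) (sym (element-lowerEdge i))
  rep-placed (inj₂ (i , inj₂ p)) =
    trans (element-∈ (enumerate (inUpper? i)) p) (sym (element-upperEdge i))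

  anchor-place : ∀ i p → anchor (place i p) ≡ lower i
  anchor-place i (inj₁ p) = trans
    (anchor-cong (trans (element-∈ (enumerate (inLower? i)) p) (sym (rep-lower i))))
    (anchor-lower-vertex i)
  anchor-place i (inj₂ p) = trans
    (anchor-cong (trans (element-∈ (enumerate (inUpper? i)) p) (sym (rep-partner (lower i)))))
    (trans (anchor-partner (lower i)) (anchor-lower-vertex i))

  -- Otherwise `e` would be the lower or the upper edge of a pair. The irrelevant hypothesis is used
  -- only to refute these two cases.
  unmatched-edge : ∀ e → .(Unmatched e) → class (element edges e) ≡ target (element edges e)
  unmatched-edge e un with <-cmp (class (element edges e)) (target (element edges e))
  ... | tri≈ _ eq _ = eq
  ... | tri< lt _ _ = ⊥-elim-irr (proj₁ (un i) (injective edges (trans (sym eq) (sym (element-lowerEdge i)))))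
    where
    found = surjective pairs (element-∈ edges e , lt)
    i  = proj₁ found
    eq = proj₂ found
  ... | tri> _ _ gt = ⊥-elim-irr (proj₂ (un i) (injective edges (sym (trans (element-upperEdge i)
      (trans (cong partner eq) (trans (partner-partner _) (element-∈ edges e)))))))
    where
    found = surjective pairs {partner (element edges e)}
      (rep-partner _ , subst₂ _<_ (sym (class-partner _)) (sym (target-partner _)) gt)
    i  = proj₁ found
    eq = proj₂ found

  anchor-unmatched : ∀ (e : Refinement (E H) Unmatched) →
                     anchor (element edges (value e)) ≡ element edges (value e)
  anchor-unmatched (e , [ un ]) = trans
    (anchor-lower (<-irrefl (sym (unmatched-edge e un)))) (element-∈ edges e)

  -- An unmatched edge is its own anchor, whereas augment `i` has the matched vertex `lower i` as
  -- anchor. So vertices that are apart never meet in `X`.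
  apart-anchor : ∀ a b → Apart a b → anchor (placed a) ≡ anchor (placed b) → a ≡ b
  apart-anchor (inj₁ e) (inj₁ f) _ eq = cong inj₁ (value-injective (injective edges
    (trans (sym (anchor-unmatched e)) (trans eq (anchor-unmatched f)))))
  apart-anchor (inj₁ e@(e′ , [ un ])) (inj₂ (i , p)) _ eq = contradiction
    (subst (λ v → class v ≡ target v) (trans (sym (anchor-unmatched e)) (trans eq (anchor-place i p)))
      (unmatched-edge e′ un))
    (lower-matched i)
  apart-anchor (inj₂ (i , p)) (inj₁ e@(e′ , [ un ])) _ eq = contradiction
    (subst (λ v → class v ≡ target v) (trans (sym (anchor-unmatched e)) (trans (sym eq) (anchor-place i p)))
      (unmatched-edge e′ un))
    (lower-matched i)
  apart-anchor (inj₂ (i , p)) (inj₂ (j , q)) i≢j eq = contradiction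
    (injective pairs (trans (sym (anchor-place i p)) (trans eq (anchor-place j q)))) i≢j

  place-injective : ∀ i {p q} → place i p ≡ place i q → p ≡ q
  place-injective i {inj₁ p} {inj₁ q} eq = cong inj₁ (injective (enumerate (inLower? i)) eq)
  place-injective i {inj₂ p} {inj₂ q} eq = cong inj₂ (injective (enumerate (inUpper? i)) eq)
  -- A vertex on both sides would give `lower i` and its partner the same class.
  place-injective i {inj₁ p} {inj₂ q} eq = contradiction
    (trans (cong class (trans (sym (element-∈ (enumerate (inLower? i)) p))
      (trans (cong rep eq) (element-∈ (enumerate (inUpper? i)) q)))) (class-partner (lower i)))
    (lower-matched i)
  place-injective i {inj₂ p} {inj₁ q} eq = contradiction
    (trans (cong class (trans (sym (element-∈ (enumerate (inLower? i)) q))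
      (trans (cong rep (sym eq)) (element-∈ (enumerate (inUpper? i)) p)))) (class-partner (lower i)))
    (lower-matched i)

  placed-injective : Injective _≡_ _≡_ placed
  placed-injective {a} {b} eq with position D a b
  ... | apart ap       = apart-anchor a b ap (cong anchor eq)
  ... | together i p q = cong (λ p → inj₂ (i , p)) (place-injective i eq)

  placed-surjective : ∀ v → ∃ λ a → placed a ≡ v
  placed-surjective v with <-cmp (class v) (target v)
  ... | tri≈ _ eq _ = inj₁ (e , [ unmatched ]) , e≡v
    where
    found = surjective edges (unmatched⇒rep eq)
    e   = proj₁ found
    e≡v = proj₂ found

    unmatched : Unmatched e
    unmatched i =
        (λ e≡x → lower-matched i (unmatched-at (trans (cong (element edges) e≡x) (element-lowerEdge i))))
      , (λ e≡y → lower-matched i (sym (trans (sym (class-partner _)) (trans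
          (unmatched-at (trans (cong (element edges) e≡y) (element-upperEdge i)))
          (target-partner _)))))
      where
      unmatched-at : ∀ {w} → element edges e ≡ w → class w ≡ target w
      unmatched-at e≡w = subst (λ v → class v ≡ target v) (trans (sym e≡v) e≡w) eq
  ... | tri< lt _ _ =
    let i , eq = surjective pairs (rep-idem v , subst₂ _<_ (sym (class-rep v)) (sym (target-rep v)) lt)
        p , eq′ = surjective (enumerate (inLower? i)) (sym eq)
    in inj₂ (i , inj₁ p) , eq′
  ... | tri> _ _ gt =
    let i , eq = surjective pairs {partner v}
          (rep-partner v , subst₂ _<_ (sym (class-partner v)) (sym (target-partner v)) gt)
        p , eq′ = surjective (enumerate (inUpper? i)) (sym (trans (cong partner eq) (partner-partner v)))
    in inj₂ (i , inj₂ p) , eq′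

  class-placed : ∀ a → class (placed a) ≡ endY H (origin a)
  class-placed a = trans (sym (class-rep (placed a))) (cong class (rep-placed a))

  anchor-placed : ∀ a → anchor (placed a) ≡ endX H (origin a)
  anchor-placed a = trans (anchor-cong (sym (rep-idem (placed a)))) (cong anchor (rep-placed a))

  -- By `apart-anchor`, an outside edge comes from a common end in `Y`, that is, from a common
  -- class.
  augAdj⇒adj : ∀ {a b} → AugAdj a b → Adj G (placed a) (placed b)
  augAdj⇒adj (inside p) = p
  augAdj⇒adj (outside {a} {b} ap (a≢b , inj₁ _ , ax , bx)) = contradiction
    (cong origin (apart-anchor a b ap
      (trans (anchor-placed a) (trans ax (sym (trans (anchor-placed b) bx))))))
    a≢b
  augAdj⇒adj (outside {a} {b} ap (a≢b , inj₂ _ , ay , by)) = clique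
    (trans (class-placed a) (trans ay (sym (trans (class-placed b) by))))
    (λ eq → a≢b (cong origin (placed-injective {a} {b} eq)))

  adj⇒augAdj : ∀ a b → Adj G (placed a) (placed b) → AugAdj a b
  adj⇒augAdj a b ab with position D a b
  ... | together _ _ _ = inside ab
  ... | apart ap = outside ap (origins-differ , meet)
    where
    anchors-differ : anchor (placed a) ≢ anchor (placed b)
    anchors-differ eq = adj-irrefl G (cong placed (apart-anchor a b ap eq)) ab

    origins-differ : origin a ≢ origin b
    origins-differ eq = anchors-differ
      (trans (anchor-placed a) (trans (cong (endX H) eq) (sym (anchor-placed b))))

    meet : ∃ λ v → Incident H (origin a) v × Incident H (origin b) v
    meet with class (placed a) ≟ class (placed b)
    ... | yes eq = inj₂ (class (placed a)) , sym (class-placed a) , sym (trans eq (class-placed b))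
    -- An edge of `G` between classes joins the two sides of an augment, which share their anchor.
    ... | no neq = contradiction
      (sym (trans (anchor-cong (trans (cross⇒partner (ab , neq)) (sym (rep-partner (placed a)))))
        (anchor-partner (placed a))))
      anchors-differ

  isXAugmentation : IsXAugmentation G H
  isXAugmentation = D , (λ i → lower i , endX-lowerEdge i , endX-upperEdge i) , record
    { bijection = mk↔ₛ′ locate placed (λ a → placed-injective (placed-locate (placed a))) placed-locate
    ; adj⇔      = λ u v → mk⇔
        (λ uv → adj⇒augAdj (locate u) (locate v)
          (subst₂ (Adj G) (sym (placed-locate u)) (sym (placed-locate v)) uv))
        (λ uv → subst₂ (Adj G) (placed-locate u) (placed-locate v) (augAdj⇒adj uv))
    }
    where
    locate : Fin n → Vertex
    locate v = proj₁ (placed-surjective v)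

    placed-locate : ∀ v → placed (locate v) ≡ v
    placed-locate v = proj₂ (placed-surjective v)

-- Three neighbours of `x` come from three edges at `x`, two of which coincide.
incidenceGraph⇒incidenceMultigraph : ∀ H → IsIncidenceGraph H → IsIncidenceMultigraph H
incidenceGraph⇒incidenceMultigraph H (_ , degree≤2) x = atMostTwo⇒size≤2
  (λ y → any? λ e → endX H e ≟ x ×-dec endY H e ≟ y)
  λ { (e , ex , refl) (f , fx , refl) (g , gx , refl) → coincide
        (size≤2⇒atMostTwo (λ e → endX H e ≟ x) (degree≤2 x) ex fx gx) }
  where
  coincide : ∀ {e f g} → TwoCoincide e f g → TwoCoincide (endY H e) (endY H f) (endY H g)
  coincide = Sum.map (cong (endY H)) (Sum.map (cong (endY H)) (cong (endY H)))

-- A clique partition from an augmentation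

module FromAugmentation
  (H : BipartiteMultigraph) (H-incidence : IsIncidenceMultigraph H)
  (D : AugmentationData (lineGraph H))
  (common-end : ∀ i → ∃ λ (v : X H) →
    Incident H (AugmentationData.x D i) (inj₁ v) × Incident H (AugmentationData.y D i) (inj₁ v)) where

  open AugmentationData D

  private
    L = lineGraph H

  endX-xy : ∀ i → endX H (x i) ≡ endX H (y i)
  endX-xy i = let _ , xv , yv = common-end i in trans xv (sym yv)

  -- If xᵢ and yᵢ are parallel, then they form a component of the line graph,
  -- and Cᵢ needs a class of its own.
  class : Vertex → Y H ⊎ Fin k
  class (inj₁ e)            = inj₁ (endY H (value e))
  class (inj₂ (i , inj₁ _)) = inj₁ (endY H (x i))
  class (inj₂ (i , inj₂ _)) = if does (endY H (x i) ≟ endY H (y i)) then inj₂ i else inj₁ (endY H (y i))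

  apart⇒origin-≢xy : ∀ {i p} w → Apart (inj₂ (i , p)) w → origin w ≢ x i × origin w ≢ y i
  apart⇒origin-≢xy {i} (inj₁ (_ , [ un ])) _ =
    (λ eq → ⊥-elim-irr (proj₁ (un i) eq)) , (λ eq → ⊥-elim-irr (proj₂ (un i) eq))
  apart⇒origin-≢xy (inj₂ (j , inj₁ _)) i≢j =
    let x≢x , x≢y , _ = matching (≢-sym i≢j) in x≢x , x≢y
  apart⇒origin-≢xy (inj₂ (j , inj₂ _)) i≢j =
    let _ , x≢y , y≢y = matching i≢j in ≢-sym x≢y , ≢-sym y≢y

  apart⇒origin-≢ : ∀ a b → Apart a b → a ≢ b → origin a ≢ origin b
  apart⇒origin-≢ (inj₁ e) (inj₁ f) _ a≢b eq = a≢b (cong inj₁ (value-injective eq))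
  apart⇒origin-≢ (inj₁ e) (inj₂ (i , inj₁ p)) _ _ = proj₁ (apart⇒origin-≢xy {i} {inj₁ p} (inj₁ e) tt)
  apart⇒origin-≢ (inj₁ e) (inj₂ (i , inj₂ p)) _ _ = proj₂ (apart⇒origin-≢xy {i} {inj₂ p} (inj₁ e) tt)
  apart⇒origin-≢ (inj₂ (i , inj₁ p)) b ap _ = ≢-sym (proj₁ (apart⇒origin-≢xy {i} {inj₁ p} b ap))
  apart⇒origin-≢ (inj₂ (i , inj₂ p)) b ap _ = ≢-sym (proj₂ (apart⇒origin-≢xy {i} {inj₂ p} b ap))

  -- Meeting `x i` in `X` means meeting `y i` there too, which puts the flat edge into a triangle.
  no-common-neighbour : ∀ i w → w ≢ x i → w ≢ y i → endX H (x i) ≢ endX H w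
  no-common-neighbour i w w≢x w≢y eq = proj₂ (flat i) w
    ( (≢-sym w≢x , inj₁ (endX H w) , eq , refl)
    , (≢-sym w≢y , inj₁ (endX H w) , trans (sym (endX-xy i)) eq , refl) )

  -- The extra class `inj₂ i` occurs only if `x i` and `y i` are parallel. Then an outside neighbour
  -- of `y i` would also be one of `x i`, against flatness.
  outside-class : ∀ a b → Apart a b → Adj L (origin a) (origin b) → class a ≡ inj₁ (endY H (origin a))
  outside-class (inj₁ e) _ _ _ = refl
  outside-class (inj₂ (i , inj₁ _)) _ _ _ = refl
  outside-class (inj₂ (i , inj₂ q)) b ap ab with endY H (x i) ≟ endY H (y i)
  ... | no _   = refl
  ... | yes eq = contradiction (adjacent ab , ab) (proj₂ (flat i) (origin b))
    where
    adjacent : Adj L (y i) (origin b) → Adj L (x i) (origin b)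
    adjacent (_ , inj₁ v , yv , bv) =
      ≢-sym (proj₁ (apart⇒origin-≢xy {i} {inj₂ q} b ap)) , inj₁ v , trans (endX-xy i) yv , bv
    adjacent (_ , inj₂ v , yv , bv) =
      ≢-sym (proj₁ (apart⇒origin-≢xy {i} {inj₂ q} b ap)) , inj₂ v , trans eq yv , bv

  A≢C : ∀ i p q → class (inj₂ (i , inj₁ p)) ≢ class (inj₂ (i , inj₂ q))
  A≢C i p q eq with endY H (x i) ≟ endY H (y i)
  A≢C i p q () | yes _
  A≢C i p q eq | no neq = neq (inj₁-injective eq)

  class-origin : ∀ a → class a ≡ inj₁ (endY H (origin a)) ⊎
                 ∃ λ i → class a ≡ inj₂ i × ∃ λ p → a ≡ inj₂ (i , p)
  class-origin (inj₁ _)            = inj₁ refl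
  class-origin (inj₂ (i , inj₁ _)) = inj₁ refl
  class-origin (inj₂ (i , inj₂ p)) with endY H (x i) ≟ endY H (y i)
  ... | no _  = inj₁ refl
  ... | yes _ = inj₂ (i , refl , inj₂ p , refl)

  apart⇒endY : ∀ a b → Apart a b → class a ≡ class b → endY H (origin a) ≡ endY H (origin b)
  apart⇒endY a b ap eq with class-origin a | class-origin b
  ... | inj₁ ca | inj₁ cb = inj₁-injective (trans (sym ca) (trans eq cb))
  ... | inj₁ ca | inj₂ (_ , cb , _) = contradiction (trans (sym ca) (trans eq cb)) λ ()
  ... | inj₂ (_ , ca , _) | inj₁ cb = contradiction (trans (sym ca) (trans eq cb)) λ ()
  ... | inj₂ (i , ca , _ , refl) | inj₂ (j , cb , _ , refl) =
    contradiction (inj₂-injective (trans (sym ca) (trans eq cb))) ap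

  clique : ∀ a b → class a ≡ class b → a ≢ b → AugAdj a b
  clique a b eq a≢b with position D a b
  ... | together i (inj₁ p) (inj₁ q) = inside (Co.cliqueA (augment i) (a≢b ∘ cong λ p → inj₂ (i , inj₁ p)))
  ... | together i (inj₂ p) (inj₂ q) = inside (Co.cliqueC (augment i) (a≢b ∘ cong λ p → inj₂ (i , inj₂ p)))
  ... | together i (inj₁ p) (inj₂ q) = contradiction eq (A≢C i p q)
  ... | together i (inj₂ p) (inj₁ q) = contradiction (sym eq) (A≢C i q p)
  ... | apart ap = outside ap
    (apart⇒origin-≢ a b ap a≢b , inj₂ (endY H (origin b)) , apart⇒endY a b ap eq , refl)

  outside-endX : ∀ a b → Apart a b → Adj L (origin a) (origin b) → class a ≢ class b →
                 endX H (origin a) ≡ endX H (origin b) × endY H (origin a) ≢ endY H (origin b)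
  outside-endX a b ap ab neq = meet ab , endY-≢
    where
    endY-≢ : endY H (origin a) ≢ endY H (origin b)
    endY-≢ eq = neq (trans (outside-class a b ap ab) (trans (cong inj₁ eq)
      (sym (outside-class b a (apart-sym D {a} {b} ap) (adj-sym L ab)))))

    meet : Adj L (origin a) (origin b) → endX H (origin a) ≡ endX H (origin b)
    meet (_ , inj₁ _ , av , bv) = trans av (sym bv)
    meet (_ , inj₂ _ , av , bv) = contradiction (trans av (sym bv)) endY-≢

  neighbours-atMostTwo : ∀ {x e f g} → endX H e ≡ x → endX H f ≡ x → endX H g ≡ x →
                         TwoCoincide (endY H e) (endY H f) (endY H g)
  neighbours-atMostTwo {x} {e} {f} {g} ex fx gx = size≤2⇒atMostTwo
    (λ y → any? λ e → endX H e ≟ x ×-dec endY H e ≟ y) (H-incidence x)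
    (e , ex , refl) (f , fx , refl) (g , gx , refl)

  -- By `no-common-neighbour` the two meet in `Y`. Hence an edge that leaves the class of an augment
  -- vertex stays inside the augment.
  outside-augment : ∀ {i p} w → Apart (inj₂ (i , p)) w → Adj L (origin (inj₂ (i , p))) (origin w) →
                    class (inj₂ (i , p)) ≡ class w
  outside-augment {i} {p} w ap vw = combine-classes (outside-class (inj₂ (i , p)) w ap vw)
    (outside-class w (inj₂ (i , p)) (apart-sym D {inj₂ (i , p)} {w} ap) (adj-sym L vw)) (meet p ap vw)
    where
    combine-classes : ∀ {c d} → class (inj₂ (i , p)) ≡ inj₁ c → class w ≡ inj₁ d → c ≡ d →
                      class (inj₂ (i , p)) ≡ class w
    combine-classes c c′ refl = trans c (sym c′)

    meet : ∀ p → Apart (inj₂ (i , p)) w → Adj L (origin (inj₂ (i , p))) (origin w) →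
           endY H (origin (inj₂ (i , p))) ≡ endY H (origin w)
    meet p ap (_ , inj₂ _ , vy , wy) = trans vy (sym wy)
    meet p@(inj₁ _) ap (_ , inj₁ _ , vx , wx) =
      let w≢x , w≢y = apart⇒origin-≢xy {i} {p} w ap in
      contradiction (trans vx (sym wx)) (no-common-neighbour i (origin w) w≢x w≢y)
    meet p@(inj₂ _) ap (_ , inj₁ _ , vx , wx) =
      let w≢x , w≢y = apart⇒origin-≢xy {i} {p} w ap in
      contradiction (trans (endX-xy i) (trans vx (sym wx))) (no-common-neighbour i (origin w) w≢x w≢y)

  -- The mixed cases contradict `outside-augment`. Inside an augment there are only two sides.
  -- Outside, all three origins share an end in `X` with at most two neighbours, one of which
  -- belongs to `v`.
  cross : ∀ {u v w} → AugAdj v u → AugAdj v w → class v ≢ class u → class v ≢ class w → class u ≡ class w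
  cross {w = w} (inside {i} {p} _) (outside ap vw) _ v≢w =
    contradiction (outside-augment {i} {p} w ap vw) v≢w
  cross {u = u} (outside ap vu) (inside {i} {p} _) v≢u _ =
    contradiction (outside-augment {i} {p} u ap vu) v≢u
  cross (inside {i} {p} {q} _) (inside {q = r} _) v≢u v≢w = sides p q r v≢u v≢w
    where
    sides : ∀ p q r → class (inj₂ (i , p)) ≢ class (inj₂ (i , q)) →
            class (inj₂ (i , p)) ≢ class (inj₂ (i , r)) → class (inj₂ (i , q)) ≡ class (inj₂ (i , r))
    sides _        (inj₁ _) (inj₁ _) _   _   = refl
    sides _        (inj₂ _) (inj₂ _) _   _   = refl
    sides (inj₁ _) (inj₁ _) (inj₂ _) v≢u _   = contradiction refl v≢u
    sides (inj₁ _) (inj₂ _) (inj₁ _) _   v≢w = contradiction refl v≢w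
    sides (inj₂ _) (inj₁ _) (inj₂ _) _   v≢w = contradiction refl v≢w
    sides (inj₂ _) (inj₂ _) (inj₁ _) v≢u _   = contradiction refl v≢u
  cross {u} {v} {w} (outside ap vu) (outside ap′ vw) v≢u v≢w
    with outside-endX v u ap vu v≢u | outside-endX v w ap′ vw v≢w
  ... | xvu , yvu | xvw , yvw with neighbours-atMostTwo refl (sym xvu) (sym xvw)
  ... | inj₁ eq        = contradiction eq yvu
  ... | inj₂ (inj₁ eq) = contradiction eq yvw
  ... | inj₂ (inj₂ eq) = trans (outside-class u v (apart-sym D {v} {u} ap) (adj-sym L vu))
    (trans (cong inj₁ eq) (sym (outside-class w v (apart-sym D {v} {w} ap′) (adj-sym L vw))))

  partition : CliquePartition augmented
  partition = record
    { class  = join _ _ ∘ class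
    ; clique = λ {a} {b} eq → clique a b (join-injective eq)
    ; cross  = λ vu vw v≢u v≢w → cong (join _ _) (cross vu vw (v≢u ∘ cong (join _ _)) (v≢w ∘ cong (join _ _)))
    }
    where
    join-injective : ∀ {m n} {s t : Fin m ⊎ Fin n} → join m n s ≡ join m n t → s ≡ t
    join-injective {m} {n} {s} {t} eq = trans (sym (splitAt-join m n s))
      (trans (cong (splitAt m) eq) (splitAt-join m n t))

-- Transport along isomorphisms and the equivalences

pullback : ∀ {V W} {G : SimpleGraph V} {G′ : SimpleGraph W} → G ≅ G′ →
           CliquePartition G′ → CliquePartition G
pullback ι Π = record
  { class  = class ∘ to
  ; clique = λ {u} {v} eq u≢v → Equivalence.from (adj⇔ ι u v)
      (clique eq λ to≡ → u≢v (trans (sym (strictlyInverseʳ u)) (trans (cong from to≡) (strictlyInverseʳ v))))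
  ; cross  = λ {u} {v} {w} vu vw →
      cross (Equivalence.to (adj⇔ ι v u) vu) (Equivalence.to (adj⇔ ι v w) vw)
  }
  where
  open CliquePartition Π
  open Inverse (bijection ι)

theorem22 : (n : ℕ) (G : SimpleGraph (Fin n)) →
    let S₁ = AdmitsFree G (ᵇP₃ ∷ ʳP₃ ∷ ᵇK₃ ∷ [])
        S₂ = AdmitsFree G (ᵇP₃ ∷ ʳP₃ ∷ ʳK₃ ∷ [])
        S₃ = AdmitsFree G (ᵇP₃ ∷ ʳP₃ ∷ ᵇK₃ ∷ ʳʳᵇK₃ ∷ [])
        S₄ = AdmitsFree G (ᵇP₃ ∷ ʳP₃ ∷ ʳK₃ ∷ ʳᵇᵇK₃ ∷ [])
        S₅ = ∃ λ (H : BipartiteMultigraph) → IsIncidenceMultigraph H × IsXAugmentation G H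
        S₆ = ∃ λ (H : BipartiteMultigraph) → IsIncidenceGraph H × IsXAugmentation G H
    in (S₁ ⇔ S₂) × (S₂ ⇔ S₃) × (S₃ ⇔ S₄) × (S₄ ⇔ S₅) × (S₅ ⇔ S₆)
theorem22 n G =
    -- Statements (1), (2) and (5) yield a partition, and a partition yields (3), (4) and (6). The
    -- steps from (3) to (1), (4) to (2) and (6) to (5) are weakenings.
    mk⇔ (S₄⇒S₂ ∘ S₄⇐ ∘ S₁⇒) (S₃⇒S₁ ∘ S₃⇐ ∘ S₂⇒)
  , mk⇔ (S₃⇐ ∘ S₂⇒) (S₄⇒S₂ ∘ S₄⇐ ∘ S₁⇒ ∘ S₃⇒S₁)
  , mk⇔ (S₄⇐ ∘ S₁⇒ ∘ S₃⇒S₁) (S₃⇐ ∘ S₂⇒ ∘ S₄⇒S₂)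
  , mk⇔ (S₆⇒S₅ ∘ S₆⇐ ∘ S₂⇒ ∘ S₄⇒S₂) (S₄⇐ ∘ S₅⇒)
  , mk⇔ (S₆⇐ ∘ S₅⇒) S₆⇒S₅
  where
  from-free : ∀ (χ : Colouring G) d → (∀ c → ¬ Contains (G , χ) (monoP₃ c)) →
              ¬ Contains (G , χ) (colouredK₃ d d d) → CliquePartition G
  from-free χ d noPath noTriangle = FromColouring.partition χ d
    (noPath _ ∘ monoPath⇒contains χ _≟_) (noTriangle ∘ triangle⇒contains χ _≟_)

  S₁⇒ : AdmitsFree G (ᵇP₃ ∷ ʳP₃ ∷ ᵇK₃ ∷ []) → CliquePartition G
  S₁⇒ (χ , free) = from-free χ blue
    (λ { red → free (there (here refl)) ; blue → free (here refl) }) (free (there (there (here refl))))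

  S₂⇒ : AdmitsFree G (ᵇP₃ ∷ ʳP₃ ∷ ʳK₃ ∷ []) → CliquePartition G
  S₂⇒ (χ , free) = from-free χ red
    (λ { red → free (there (here refl)) ; blue → free (here refl) }) (free (there (there (here refl))))

  S₃⇐ : CliquePartition G → AdmitsFree G (ᵇP₃ ∷ ʳP₃ ∷ ᵇK₃ ∷ ʳʳᵇK₃ ∷ [])
  S₃⇐ Π = colouring-by-class , λ
    { (here refl)                         → noMonoPath ∘ contains⇒monoPath _
    ; (there (here refl))                 → noMonoPath ∘ contains⇒monoPath _
    ; (there (there (here refl)))         → noOppositeTriangle (λ ()) ∘ contains⇒triangle _
    ; (there (there (there (here refl)))) → noTriangle-ccd (λ ()) ∘ contains⇒triangle _
    }
    where open FromPartition Π red

  S₄⇐ : CliquePartition G → AdmitsFree G (ᵇP₃ ∷ ʳP₃ ∷ ʳK₃ ∷ ʳᵇᵇK₃ ∷ [])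
  S₄⇐ Π = colouring-by-class , λ
    { (here refl)                         → noMonoPath ∘ contains⇒monoPath _
    ; (there (here refl))                 → noMonoPath ∘ contains⇒monoPath _
    ; (there (there (here refl)))         → noOppositeTriangle (λ ()) ∘ contains⇒triangle _
    ; (there (there (there (here refl)))) → noTriangle-dcc (λ ()) ∘ contains⇒triangle _
    }
    where open FromPartition Π blue

  S₃⇒S₁ : AdmitsFree G (ᵇP₃ ∷ ʳP₃ ∷ ᵇK₃ ∷ ʳʳᵇK₃ ∷ []) → AdmitsFree G (ᵇP₃ ∷ ʳP₃ ∷ ᵇK₃ ∷ [])
  -- The shorter list of patterns is a prefix of the longer one.
  S₃⇒S₁ = map₂ (λ free P∈ → free (∈-++⁺ˡ P∈))

  S₄⇒S₂ : AdmitsFree G (ᵇP₃ ∷ ʳP₃ ∷ ʳK₃ ∷ ʳᵇᵇK₃ ∷ []) → AdmitsFree G (ᵇP₃ ∷ ʳP₃ ∷ ʳK₃ ∷ [])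
  S₄⇒S₂ = map₂ (λ free P∈ → free (∈-++⁺ˡ P∈))

  S₆⇐ : CliquePartition G → ∃ λ H → IsIncidenceGraph H × IsXAugmentation G H
  S₆⇐ Π = H , H-isIncidenceGraph , isXAugmentation
    where open ToAugmentation Π

  S₆⇒S₅ : (∃ λ H → IsIncidenceGraph H × IsXAugmentation G H) →
          ∃ λ H → IsIncidenceMultigraph H × IsXAugmentation G H
  S₆⇒S₅ (H , incidence , aug) = H , incidenceGraph⇒incidenceMultigraph H incidence , aug

  S₅⇒ : (∃ λ H → IsIncidenceMultigraph H × IsXAugmentation G H) → CliquePartition G
  S₅⇒ (H , incidence , D , common-end , ι) =
    pullback ι (FromAugmentation.partition H incidence D common-end)
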